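{- Let $f:\{0,1\}^n\times\{0,1\}^n\to\{\pm1\}$ be the Inner Product function over $\mathbb{F}_2$, $f(s,x)=(-1)^{\langle s,x\rangle}$, and consider the Multiphase Problem for $f$ with $m=n^{1+c}$ for a constant $c>0$. Let $\kappa>0$ be any (large) constant. Then every cell-probe data structure for this problem with update time $t_u\le \log^{\kappa} n$ has total query time $$t_{tot}\ \ge\ \Omega\!\left(\left(\frac{\log n}{\log\log n}\right)^2\right).$$
   Context: Cell-probe model: memory consists of cells of $w=\Theta(\log n)$ bits; an algorithm is charged one unit per cell it reads or writes (a probe), and all computation on probed data is free. Multiphase Problem for $f$: first, $\vec S=(S_1,\dots,S_m)\in(\{0,1\}^n)^m$ is given and preprocessed (preprocessing is free). Then $X\in\{0,1\}^n$ is given as a sequence of $n$ updates (one per bit), each update handled with at most $t_u$ probes. Finally a query $q\in[m]$ is given and the data structure must output $f(S_q,X)$ correctly using at most $t_{tot}$ probes in total.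
   Formalization: The constant c > 0 is taken to be a positive rational p/q, with m the integer part of n^{1+c}; a real c is not covered directly. -}

module Defs where

open import Data.Nat using (ℕ; zero; suc; _+_; _*_; _^_; _≤_; _<_; _⊔_)
open import Data.Bool using (Bool; true; false; _∧_; _xor_; if_then_else_)
open import Data.Bool.Properties using () renaming (_≟_ to _≟B_)
open import Data.Fin using (Fin)
open import Data.Vec using (Vec; lookup; zipWith; foldr)
open import Data.Vec.Properties using (≡-dec)
open import Data.List using (List; []; _∷_; allFin)
open import Data.Product using (_×_; _,_)
open import Data.Unit using (⊤)
open import Relation.Nullary using (does)
open import Relation.Binary.PropositionalEquality using (_≡_)

Word : ℕ → Set
Word w = Vec Bool w

Memory : ℕ → Set
Memory w = Word w → Word w

writeMem : ∀ {w} → Word w → Word w → Memory w → Memory w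
writeMem a v M a' = if does (≡-dec _≟B_ a' a) then v else M a'

-- An adaptive cell-probe algorithm (decision tree) returning a value of type A.
-- Computation is free; each read / write of a cell is one probe.
data Prog (w : ℕ) (A : Set) : Set where
  done  : A → Prog w A
  read  : Word w → (Word w → Prog w A) → Prog w A
  write : Word w → Word w → Prog w A → Prog w A

run : ∀ {w A} → Prog w A → Memory w → A × Memory w × ℕ
run (done x) M = x , M , 0
run (read a k) M with run (k (M a)) M
... | x , M' , c = x , M' , suc c
run (write a v p) M with run p (writeMem a v M)
... | x , M' , c = x , M' , suc c

record DataStructure (n m w : ℕ) : Set where
  field
    preprocess : (Fin m → Vec Bool n) → Memory w   -- free, arbitrary
    update     : Fin n → Bool → Prog w ⊤
    query      : Fin m → Prog w Bool

-- Inner product over F₂ (true encodes -1, false encodes +1 in f = (-1)^⟨s,x⟩).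
ip : ∀ {n} → Vec Bool n → Vec Bool n → Bool
ip s x = foldr _ _xor_ false (zipWith _∧_ s x)

runUpdates : ∀ {n m w} → DataStructure n m w → Vec Bool n → List (Fin n)
           → Memory w → Memory w × ℕ
runUpdates ds X [] M = M , 0
runUpdates ds X (i ∷ is) M with run (DataStructure.update ds i (lookup X i)) M
... | _ , M' , c with runUpdates ds X is M'
...   | M'' , c' = M'' , (c ⊔ c')

Solves : ∀ {n m w} → DataStructure n m w → ℕ → ℕ → Set
Solves {n} {m} {w} ds tu tq =
  (S : Fin m → Vec Bool n) (X : Vec Bool n) (q : Fin m) →
  let (M , cu) = runUpdates ds X (allFin n) (DataStructure.preprocess ds S)
      (out , _ , cq) = run (DataStructure.query ds q) M
  in (cu ≤ tu) × (out ≡ ip (S q) X) × (cq ≤ tq)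

-- m = ⌊ n ^ ((p + q) / q) ⌋, i.e. m = ⌊n^{1+c}⌋ with c = p/q.
IsFloorPow : ℕ → ℕ → ℕ → ℕ → Set
IsFloorPow n p q m = (m ^ q ≤ n ^ (p + q)) × (n ^ (p + q) < suc m ^ q)

{-# OPTIONS --safe #-}
-- Cut the updates, counted backwards from the last one, into epochs [Z, βZ) with Z = β^k and
-- β = polylog n; there are J = Θ(log n / log log n) of them with √n ≲ Z. A read cell belongs to
-- the epoch of its last write, so each query meets some epoch in at most t = tq / J cells. These
-- lie in at most t of the β blocks of Z updates of the epoch; hence for every (S, X) some epoch
-- and some choice of t blocks cover a β^-(t+1) fraction of all queries.
--
-- Fix such an epoch. The advice consists of the updates before it and the final contents of the
-- cells written in its chosen blocks or after it, o(βZ) bits. Advice and S determine a simulation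
-- of all queries, and the certificate, the list of the βZ tu cells written from the epoch on, shows
-- which of the simulations are right: those reading no certificate cell outside the advice. So X
-- has a certificate that reveals many of the m bits S X. If a fixed advice and transcript served
-- more than 2^r vectors X for the same S, then r linearly independent ones among them would each
-- impose many linear conditions on S; as m ≥ n^(1+c), too few S are left for the union bound over
-- the r vectors and their certificates. Hence there are too few pairs (S, X) altogether unless
-- tq = Ω(J²).
module Submission where

open import Defs
import Algebra.Properties.CommutativeSemigroup as CommutativeSemigroupProperties
open import Algebra.Bundles using (CommutativeMonoid; CommutativeRing)
open import Data.Bool using (Bool; true; false; _∧_; _xor_; if_then_else_)
open import Data.Bool.Properties using (∧-identityʳ; ∧-zeroʳ; xor-comm; xor-assoc; xor-identityʳ; ∧-distribˡ-xor; xor-∧-commutativeRing)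
  renaming (_≟_ to _≟ᵇ_)
open import Data.Empty using (⊥)
open import Data.Fin using (Fin; zero; suc; toℕ; fromℕ<)
open import Data.Fin.Properties using (all?; toℕ-fromℕ<; toℕ<n)
open import Data.List using (List; []; _∷_; _++_; map; concatMap; length; tabulate; allFin; take; drop; cartesianProduct; downFrom; upTo)
import Data.List.Properties as Listₚ
open import Data.List.Membership.Propositional using (find; lose) renaming (_∈_ to _∈ₗ_)
open import Data.List.Membership.Propositional.Properties
  using (∈-map⁺; ∈-concat⁺′; ∈-cartesianProduct⁺; ∈-cartesianProduct⁻; ∈-downFrom⁻; ∈-upTo⁺)
import Data.List.Relation.Unary.All as ListAll
open ListAll using ([]; _∷_)
open import Data.List.Relation.Unary.Any using (Any; any?; here; there)
open import Data.Maybe using (Maybe; just; nothing)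
open import Data.Nat
  using (ℕ; zero; suc; _+_; _*_; _∸_; _^_; _≤_; _<_; _≥_; z≤n; s≤s; s≤s⁻¹; _⊔_; NonZero; _≤?_; _<?_; >-nonZero; >-nonZero⁻¹; ⌊_/2⌋; ⌈_/2⌉)
open import Data.Nat.DivMod using (_/_; _%_; m≡m%n+[m/n]*n; m%n<n; m/n*n≤m; m/n≤m; m<n*o⇒m/o<n)
open import Data.Nat.Logarithm using (⌊log₂_⌋; ⌊log₂⌋-mono-≤; ⌊log₂[2^n]⌋≡n; ⌊log₂⌊n/2⌋⌋≡⌊log₂n⌋∸1)
open import Data.Nat.Properties
open import Data.Nat.Tactic.RingSolver using (solve-∀)
open import Data.Product using (_×_; _,_; ∃-syntax; Σ-syntax; proj₁; proj₂)
open import Data.Sum using (_⊎_; inj₁; inj₂)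
open import Data.Vec using (Vec; []; _∷_; lookup; replicate; zipWith; concat)
import Data.Vec as Vec
open import Data.Vec.Properties using (≡-dec; map-∘; map-id; lookup∘tabulate; length-toList)
open import Data.Vec.Membership.Propositional using (_∈_)
import Data.Vec.Membership.Propositional.Properties as ∈ᵥ
open ∈ᵥ using (∈-tabulate⁺; ∈-lookup; ∈-toList⁺)
import Data.Vec.Membership.DecPropositional as DecMembership
open import Data.Vec.Relation.Binary.Pointwise.Inductive using (Pointwise; []; _∷_)
import Data.Vec.Relation.Unary.All as VecAll
open VecAll using ([]; _∷_)
open import Data.Vec.Relation.Unary.All.Properties using (lookup⁻)
open import Data.Vec.Relation.Unary.Any using (here; there)
import Data.Vec.Relation.Unary.Any as VecAny
open import Data.Vec.Relation.Unary.Any.Properties using (concat⁺; concat⁻; tabulate⁻)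
open import Function using (_∘_; id)
open import Relation.Binary.PropositionalEquality
  using (_≡_; refl; sym; trans; cong; cong₂; subst; subst₂; module ≡-Reasoning)
open import Relation.Nullary using (Dec; yes; no; ¬_; ¬?; does)
open import Relation.Nullary.Decidable using (_⊎-dec_; _×-dec_)
open import Relation.Nullary.Negation using (contradiction)
open import Relation.Unary using (Decidable)

open CommutativeSemigroupProperties +-commutativeSemigroup using () renaming (interchange to +-interchange)
open CommutativeSemigroupProperties (CommutativeMonoid.commutativeSemigroup (CommutativeRing.+-commutativeMonoid xor-∧-commutativeRing))
  using () renaming (interchange to xor-interchange)

-- Finite sums and enumerations

∑ : ∀ {A : Set} → List A → (A → ℕ) → ℕ
∑ []       f = 0
∑ (x ∷ xs) f = f x + ∑ xs f

∑-mono : ∀ {A : Set} (xs : List A) {f g} → (∀ x → f x ≤ g x) → ∑ xs f ≤ ∑ xs g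
∑-mono []       f≤g = z≤n
∑-mono (x ∷ xs) f≤g = +-mono-≤ (f≤g x) (∑-mono xs f≤g)

∑-cong : ∀ {A : Set} (xs : List A) {f g} → (∀ x → f x ≡ g x) → ∑ xs f ≡ ∑ xs g
∑-cong []       f≡g = refl
∑-cong (x ∷ xs) f≡g = cong₂ _+_ (f≡g x) (∑-cong xs f≡g)

∑-+ : ∀ {A : Set} (xs : List A) f g → ∑ xs (λ x → f x + g x) ≡ ∑ xs f + ∑ xs g
∑-+ []       f g = refl
∑-+ (x ∷ xs) f g = begin
  (f x + g x) + ∑ xs (λ x → f x + g x) ≡⟨ cong (f x + g x +_) (∑-+ xs f g) ⟩
  (f x + g x) + (∑ xs f + ∑ xs g)      ≡⟨ +-interchange (f x) (g x) (∑ xs f) (∑ xs g) ⟩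
  (f x + ∑ xs f) + (g x + ∑ xs g)      ∎
  where open ≡-Reasoning

∑-*ʳ : ∀ {A : Set} (xs : List A) f c → ∑ xs (λ x → f x * c) ≡ ∑ xs f * c
∑-*ʳ []       f c = refl
∑-*ʳ (x ∷ xs) f c = trans (cong (f x * c +_) (∑-*ʳ xs f c)) (sym (*-distribʳ-+ c (f x) (∑ xs f)))

∑-const : ∀ {A : Set} (xs : List A) c → ∑ xs (λ _ → c) ≡ length xs * c
∑-const []       c = refl
∑-const (x ∷ xs) c = cong (c +_) (∑-const xs c)

∑-bound∈ : ∀ {A : Set} (xs : List A) {f c} → (∀ x → x ∈ₗ xs → f x ≤ c) → ∑ xs f ≤ length xs * c
∑-bound∈ []       f≤c = z≤n
∑-bound∈ (x ∷ xs) f≤c = +-mono-≤ (f≤c x (here refl)) (∑-bound∈ xs (λ y y∈ → f≤c y (there y∈)))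

∑-bound : ∀ {A : Set} (xs : List A) {f c} → (∀ x → f x ≤ c) → ∑ xs f ≤ length xs * c
∑-bound xs f≤c = ∑-bound∈ xs (λ x _ → f≤c x)

∑-swap : ∀ {A B : Set} (xs : List A) (ys : List B) (f : A → B → ℕ) →
         ∑ xs (λ x → ∑ ys (f x)) ≡ ∑ ys (λ y → ∑ xs (λ x → f x y))
∑-swap []       ys f = sym (trans (∑-const ys 0) (*-zeroʳ (length ys)))
∑-swap (x ∷ xs) ys f =
  trans (cong (∑ ys (f x) +_) (∑-swap xs ys f)) (sym (∑-+ ys (f x) (λ y → ∑ xs (λ x → f x y))))

∈⇒≤∑ : ∀ {A : Set} {xs : List A} {x} (f : A → ℕ) → x ∈ₗ xs → f x ≤ ∑ xs f
∈⇒≤∑ {xs = x ∷ xs} f (here refl) = m≤m+n (f x) (∑ xs f)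
∈⇒≤∑ {xs = y ∷ xs} f (there x∈)  = ≤-trans (∈⇒≤∑ f x∈) (m≤n+m (∑ xs f) (f y))

∑-map : ∀ {A B : Set} (g : A → B) xs f → ∑ (map g xs) f ≡ ∑ xs (f ∘ g)
∑-map g []       f = refl
∑-map g (x ∷ xs) f = cong (f (g x) +_) (∑-map g xs f)

∑-++ : ∀ {A : Set} (xs ys : List A) f → ∑ (xs ++ ys) f ≡ ∑ xs f + ∑ ys f
∑-++ []       ys f = refl
∑-++ (x ∷ xs) ys f = trans (cong (f x +_) (∑-++ xs ys f)) (sym (+-assoc (f x) (∑ xs f) (∑ ys f)))

∑-concatMap : ∀ {A B : Set} (g : A → List B) xs f → ∑ (concatMap g xs) f ≡ ∑ xs (λ x → ∑ (g x) f)
∑-concatMap g []       f = refl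
∑-concatMap g (x ∷ xs) f =
  trans (∑-++ (g x) (concatMap g xs) f) (cong (∑ (g x) f +_) (∑-concatMap g xs f))

∑-tabulate : ∀ {A : Set} {k} (g : Fin k → A) f → ∑ (tabulate g) f ≡ ∑ (allFin k) (f ∘ g)
∑-tabulate {k = zero}  g f = refl
∑-tabulate {k = suc k} g f = cong (f (g zero) +_)
  (trans (∑-tabulate (g ∘ suc) f) (sym (∑-tabulate suc (f ∘ g))))

∑-allFin-suc : ∀ {k} (f : Fin (suc k) → ℕ) → ∑ (allFin (suc k)) f ≡ f zero + ∑ (allFin k) (f ∘ suc)
∑-allFin-suc f = cong (f zero +_) (∑-tabulate suc f)

∑-positive : ∀ {A : Set} (xs : List A) f → ∑ xs f ≡ 0 ⊎ ∃[ x ] (1 ≤ f x)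
∑-positive []       f = inj₁ refl
∑-positive (x ∷ xs) f with f x in eq | ∑-positive xs f
... | suc k | _        = inj₂ (x , subst (1 ≤_) (sym eq) (s≤s z≤n))
... | zero  | inj₁ ≡0  = inj₁ ≡0
... | zero  | inj₂ y   = inj₂ y

pigeonhole : ∀ {A : Set} (xs : List A) f c → 1 ≤ length xs → c * length xs ≤ ∑ xs f →
             ∃[ x ] (x ∈ₗ xs × c ≤ f x)
pigeonhole (x ∷ xs) f c _ le with c ≤? f x
... | yes c≤ = x , here refl , c≤
pigeonhole (x ∷ []) f c _ le | no c≰ =
  contradiction (subst₂ _≤_ (*-identityʳ c) (+-identityʳ (f x)) le) c≰
pigeonhole (x ∷ xs@(_ ∷ _)) f c _ le | no c≰ with pigeonhole xs f c (s≤s z≤n) le′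
  where
  le′ : c * length xs ≤ ∑ xs f
  le′ = +-cancelˡ-≤ c _ _ (begin
    c + c * length xs    ≡⟨ sym (*-suc c (length xs)) ⟩
    c * suc (length xs)  ≤⟨ le ⟩
    f x + ∑ xs f         ≤⟨ +-monoˡ-≤ (∑ xs f) (<⇒≤ (≰⇒> c≰)) ⟩
    c + ∑ xs f           ∎)
    where open ≤-Reasoning
... | y , y∈ , c≤ = y , there y∈ , c≤

𝟙 : ∀ {P : Set} → Dec P → ℕ
𝟙 P? = if does P? then 1 else 0

𝟙-yes : ∀ {P : Set} (P? : Dec P) → P → 𝟙 P? ≡ 1
𝟙-yes (yes _) p = refl
𝟙-yes (no ¬p) p = contradiction p ¬p

𝟙-inv : ∀ {P : Set} (P? : Dec P) → 1 ≤ 𝟙 P? → P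
𝟙-inv (yes p) _ = p

𝟙≤ : ∀ {P : Set} (P? : Dec P) {c} → (P → 1 ≤ c) → 𝟙 P? ≤ c
𝟙≤ (yes p) f = f p
𝟙≤ (no _)  f = z≤n

vecs : ∀ {A : Set} → List A → ∀ k → List (Vec A k)
vecs xs zero    = [] ∷ []
vecs xs (suc k) = concatMap (λ x → map (x ∷_) (vecs xs k)) xs

∑-vecs-suc : ∀ {A : Set} (xs : List A) k f → ∑ (vecs xs (suc k)) f ≡ ∑ xs (λ x → ∑ (vecs xs k) (λ v → f (x ∷ v)))
∑-vecs-suc xs k f = trans (∑-concatMap _ xs f) (∑-cong xs (λ x → ∑-map (x ∷_) (vecs xs k) f))

length≡∑1 : ∀ {A : Set} (xs : List A) → length xs ≡ ∑ xs (λ _ → 1)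
length≡∑1 xs = sym (trans (∑-const xs 1) (*-identityʳ (length xs)))

length-vecs : ∀ {A : Set} (xs : List A) k → length (vecs xs k) ≡ length xs ^ k
length-vecs xs zero    = refl
length-vecs xs (suc k) = begin
  length (vecs xs (suc k))                   ≡⟨ length≡∑1 (vecs xs (suc k)) ⟩
  ∑ (vecs xs (suc k)) (λ _ → 1)              ≡⟨ ∑-vecs-suc xs k _ ⟩
  ∑ xs (λ _ → ∑ (vecs xs k) (λ _ → 1))       ≡⟨ ∑-const xs _ ⟩
  length xs * ∑ (vecs xs k) (λ _ → 1)        ≡⟨ cong (length xs *_) (sym (length≡∑1 (vecs xs k))) ⟩
  length xs * length (vecs xs k)             ≡⟨ cong (length xs *_) (length-vecs xs k) ⟩
  length xs * length xs ^ k                  ∎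
  where open ≡-Reasoning

∈-vecs : ∀ {A : Set} {xs : List A} {k} {v : Vec A k} → VecAll.All (_∈ₗ xs) v → v ∈ₗ vecs xs k
∈-vecs []             = here refl
∈-vecs {v = x ∷ v} (x∈ ∷ v∈) = ∈-concat⁺′ (∈-map⁺ (x ∷_) (∈-vecs v∈)) (∈-map⁺ _ x∈)

∈-vecs-full : ∀ {A : Set} {xs : List A} → (∀ x → x ∈ₗ xs) → ∀ {k} (v : Vec A k) → v ∈ₗ vecs xs k
∈-vecs-full full v = ∈-vecs (VecAll.universal full v)

bits : List Bool
bits = false ∷ true ∷ []

∈-bits : ∀ b → b ∈ₗ bits
∈-bits false = here refl
∈-bits true  = there (here refl)

cube : ∀ n → List (Vec Bool n)
cube = vecs bits

∈-cube : ∀ {n} (v : Vec Bool n) → v ∈ₗ cube n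
∈-cube = ∈-vecs-full ∈-bits

length-cube : ∀ n → length (cube n) ≡ 2 ^ n
length-cube = length-vecs bits

∑-cube-suc : ∀ n f → ∑ (cube (suc n)) f ≡ ∑ (cube n) (λ v → f (false ∷ v)) + ∑ (cube n) (λ v → f (true ∷ v))
∑-cube-suc n f = trans (∑-vecs-suc bits n f)
  (cong (∑ (cube n) (λ v → f (false ∷ v)) +_) (+-identityʳ _))

∑-*ˡ : ∀ {A : Set} (xs : List A) c f → ∑ xs (λ x → c * f x) ≡ c * ∑ xs f
∑-*ˡ xs c f = trans (∑-cong xs (λ x → *-comm c (f x))) (trans (∑-*ʳ xs f c) (*-comm (∑ xs f) c))

length-cartesianProduct : ∀ {A B : Set} (xs : List A) (ys : List B) →
                          length (cartesianProduct xs ys) ≡ length xs * length ys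
length-cartesianProduct xs ys = trans (length≡∑1 (cartesianProduct xs ys)) (count xs)
  where
  count : ∀ xs → ∑ (cartesianProduct xs ys) (λ _ → 1) ≡ length xs * length ys
  count []       = refl
  count (x ∷ xs) = trans (∑-++ (map (x ,_) ys) (cartesianProduct xs ys) _)
    (cong₂ _+_ (trans (∑-map (x ,_) ys _) (sym (length≡∑1 ys))) (count xs))

-- A union bound with denominators cleared: each y accounts for at most c / e, and the factor e
-- stays on the left so that everything remains in ℕ.
cover-bound : ∀ {A B : Set} (xs : List A) (ys : List B) {f : A → ℕ} {g : B → A → ℕ} {c} e →
              (∀ x → f x ≤ ∑ ys (λ y → g y x)) → (∀ y → ∑ xs (g y) * e ≤ c) →
              ∑ xs f * e ≤ length ys * c
cover-bound xs ys {f} {g} {c} e f≤ g≤ = begin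
  ∑ xs f * e                          ≤⟨ *-monoˡ-≤ e (∑-mono xs f≤) ⟩
  ∑ xs (λ x → ∑ ys (λ y → g y x)) * e ≡⟨ cong (_* e) (∑-swap xs ys (λ x y → g y x)) ⟩
  ∑ ys (λ y → ∑ xs (g y)) * e         ≡⟨ sym (∑-*ʳ ys _ e) ⟩
  ∑ ys (λ y → ∑ xs (g y) * e)         ≤⟨ ∑-bound ys g≤ ⟩
  length ys * c                       ∎
  where open ≤-Reasoning

-- Lets a union bound range over all candidates although the estimate is known only for those with
-- P; for the others the gate makes the sum vanish.
gated-bound : ∀ {A P : Set} (xs : List A) (P? : Dec P) (f : A → ℕ) {c e} →
              (P → ∑ xs f * e ≤ c) → ∑ xs (λ x → 𝟙 P? * f x) * e ≤ c
gated-bound xs (yes p) f {c} {e} bound =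
  ≤-trans (≤-reflexive (cong (_* e) (∑-cong xs (λ x → +-identityʳ (f x))))) (bound p)
gated-bound xs (no _) f {c} {e} bound =
  ≤-trans (≤-reflexive (cong (_* e) (trans (∑-const xs 0) (*-zeroʳ (length xs))))) z≤n

-- Linear independence over F₂

_⊕_ : ∀ {n} → Vec Bool n → Vec Bool n → Vec Bool n
_⊕_ = zipWith _xor_

ip-⊕ : ∀ {n} (s x y : Vec Bool n) → ip s (x ⊕ y) ≡ ip s x xor ip s y
ip-⊕ []      []      []      = refl
ip-⊕ (a ∷ s) (b ∷ x) (c ∷ y) = begin
  (a ∧ (b xor c)) xor ip s (x ⊕ y)                  ≡⟨ cong₂ _xor_ (∧-distribˡ-xor a b c) (ip-⊕ s x y) ⟩
  ((a ∧ b) xor (a ∧ c)) xor (ip s x xor ip s y)     ≡⟨ xor-interchange (a ∧ b) (a ∧ c) (ip s x) (ip s y) ⟩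
  ((a ∧ b) xor ip s x) xor ((a ∧ c) xor ip s y)     ∎
  where open ≡-Reasoning

-- Translation permutes the cube: a leading `false` of y preserves its two halves, a leading `true`
-- swaps them.
∑-cube-translate : ∀ n (y : Vec Bool n) f → ∑ (cube n) (λ z → f (z ⊕ y)) ≡ ∑ (cube n) f
∑-cube-translate zero    []          f = refl
∑-cube-translate (suc n) (false ∷ y) f = begin
  ∑ (cube (suc n)) (λ z → f (z ⊕ (false ∷ y)))
    ≡⟨ ∑-cube-suc n _ ⟩
  ∑ (cube n) (λ z → f (false ∷ (z ⊕ y))) + ∑ (cube n) (λ z → f (true ∷ (z ⊕ y)))
    ≡⟨ cong₂ _+_ (∑-cube-translate n y _) (∑-cube-translate n y _) ⟩
  ∑ (cube n) (λ z → f (false ∷ z)) + ∑ (cube n) (λ z → f (true ∷ z))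
    ≡⟨ sym (∑-cube-suc n f) ⟩
  ∑ (cube (suc n)) f ∎
  where open ≡-Reasoning
∑-cube-translate (suc n) (true ∷ y) f = begin
  ∑ (cube (suc n)) (λ z → f (z ⊕ (true ∷ y)))
    ≡⟨ ∑-cube-suc n _ ⟩
  ∑ (cube n) (λ z → f (true ∷ (z ⊕ y))) + ∑ (cube n) (λ z → f (false ∷ (z ⊕ y)))
    ≡⟨ cong₂ _+_ (∑-cube-translate n y _) (∑-cube-translate n y _) ⟩
  ∑ (cube n) (λ z → f (true ∷ z)) + ∑ (cube n) (λ z → f (false ∷ z))
    ≡⟨ +-comm (∑ (cube n) (λ z → f (true ∷ z))) _ ⟩
  ∑ (cube n) (λ z → f (false ∷ z)) + ∑ (cube n) (λ z → f (true ∷ z))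
    ≡⟨ sym (∑-cube-suc n f) ⟩
  ∑ (cube (suc n)) f ∎
  where open ≡-Reasoning

-- Valued in {0,1} instead of `Set`, so that a conjunction of constraints is a product and counting
-- solutions is a `∑`.
matches : Maybe Bool → Bool → ℕ
matches nothing  b = 1
matches (just c) b = 𝟙 (c ≟ᵇ b)

satisfies : ∀ {n r} → Vec Bool n → Vec (Vec Bool n) r → Vec (Maybe Bool) r → ℕ
satisfies s []       []       = 1
satisfies s (x ∷ xs) (c ∷ cs) = matches c (ip s x) * satisfies s xs cs

defined : Maybe Bool → ℕ
defined nothing  = 0
defined (just _) = 1

#defined : ∀ {r} → Vec (Maybe Bool) r → ℕ
#defined []       = 0
#defined (c ∷ cs) = defined c + #defined cs

-- Linear independence of xs, in the only form the counting argument needs: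
-- prescribing j of the products ⟨s,x⟩ leaves at most a 2^-j fraction of the s.
Independent : ∀ {n r} → Vec (Vec Bool n) r → Set
Independent {n} xs = ∀ cs → ∑ (cube n) (λ s → satisfies s xs cs) * 2 ^ #defined cs ≤ 2 ^ n

private
  constraints : ∀ r → List (Vec (Maybe Bool) r)
  constraints = vecs (nothing ∷ map just bits)

  ∈-constraints : ∀ {r} (cs : Vec (Maybe Bool) r) → cs ∈ₗ constraints r
  ∈-constraints = ∈-vecs-full λ { nothing → here refl ; (just b) → there (∈-map⁺ just (∈-bits b)) }

-- Only finitely many prescriptions `cs` exist, so they can all be tested. `heavy-bound` needs the
-- decision to gate its sum by independence.
independent? : ∀ {n r} → Decidable (Independent {n} {r})
independent? {n} xs with ListAll.all? (λ cs → ∑ (cube n) (λ s → satisfies s xs cs) * 2 ^ #defined cs ≤? 2 ^ n) (constraints _)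
... | yes all = yes (λ cs → ListAll.lookup all (∈-constraints cs))
... | no ¬all = no (λ ind → ¬all (ListAll.universal ind (constraints _)))

-- x lifts z along the quotient by the line spanned by (true ∷ y), on which the first
-- coordinate is eliminated; once ⟨(a ∷ s), (true ∷ y)⟩ is known, ⟨(a ∷ s), x⟩ and ⟨s, z⟩ determine each other.
private
  Lifts : ∀ {n} → Vec Bool n → Vec Bool (suc n) → Vec Bool n → Set
  Lifts y x z = ∃[ b ] ∀ a s → ip (a ∷ s) x ≡ ip s z xor (b ∧ (a xor ip s y))

  -- The two points differ by `true ∷ y`, hence form the coset that the quotient sends to z.
  Fibre : ∀ {n} → (Vec Bool (suc n) → Set) → Vec Bool n → Vec Bool n → Set
  Fibre A y z = A (false ∷ z) ⊎ A (true ∷ (z ⊕ y))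

  lift-one : ∀ {n} (A : Vec Bool (suc n) → Set) (y z : Vec Bool n) → Fibre A y z → ∃[ x ] (A x × Lifts y x z)
  lift-one A y z (inj₁ a₀) = false ∷ z , a₀ , false , λ a s →
    trans (cong (_xor ip s z) (∧-zeroʳ a)) (sym (xor-identityʳ (ip s z)))
  lift-one A y z (inj₂ a₁) = true ∷ (z ⊕ y) , a₁ , true , λ a s → begin
    (a ∧ true) xor ip s (z ⊕ y)       ≡⟨ cong₂ _xor_ (∧-identityʳ a) (ip-⊕ s z y) ⟩
    a xor (ip s z xor ip s y)         ≡⟨ xor-assoc a (ip s z) (ip s y) ⟨
    (a xor ip s z) xor ip s y         ≡⟨ cong (_xor ip s y) (xor-comm a (ip s z)) ⟩
    (ip s z xor a) xor ip s y         ≡⟨ xor-assoc (ip s z) a (ip s y) ⟩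
    ip s z xor (a xor ip s y)         ∎
    where open ≡-Reasoning

  lift-all : ∀ {n r} (A : Vec Bool (suc n) → Set) y (zs : Vec (Vec Bool n) r) → VecAll.All (Fibre A y) zs →
             Σ[ xs ∈ Vec (Vec Bool (suc n)) r ] (VecAll.All A xs × Pointwise (Lifts y) xs zs)
  lift-all A y []       []         = [] , [] , []
  lift-all A y (z ∷ zs) (fz ∷ fzs) with lift-one A y z fz | lift-all A y zs fzs
  ... | x , Ax , l | xs , Axs , ls = x ∷ xs , Ax ∷ Axs , l ∷ ls

  cancel-xor : ∀ c z e → matches (just c) (z xor e) ≡ matches (just (c xor e)) z
  cancel-xor false false false = refl
  cancel-xor false false true  = refl
  cancel-xor false true  false = refl
  cancel-xor false true  true  = refl
  cancel-xor true  false false = refl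
  cancel-xor true  false true  = refl
  cancel-xor true  true  false = refl
  cancel-xor true  true  true  = refl

  -- Once the product with the pivot `true ∷ y` is known to be d, prescribing c for the product with
  -- x amounts to prescribing c xor (b ∧ d) for the product with z. The number of prescriptions does
  -- not change.
  shift : ∀ {n r} y {xs : Vec (Vec Bool (suc n)) r} {zs : Vec (Vec Bool n) r} → Pointwise (Lifts y) xs zs → ∀ d cs →
          ∃[ cs′ ] (#defined cs′ ≡ #defined cs ×
                    (∀ a s → a xor ip s y ≡ d → satisfies (a ∷ s) xs cs ≡ satisfies s zs cs′))
  shift y [] d [] = [] , refl , λ a s eq → refl
  shift y ((b , l) ∷ ls) d (nothing ∷ cs) with shift y ls d cs
  ... | cs′ , # , eq = nothing ∷ cs′ , # , λ a s e → cong (1 *_) (eq a s e)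
  shift y {zs = z ∷ _} ((b , l) ∷ ls) d (just c ∷ cs) with shift y ls d cs
  ... | cs′ , # , eq = just (c xor (b ∧ d)) ∷ cs′ , cong suc # , λ a s e → cong₂ _*_
      (trans (cong (matches (just c)) (trans (l a s) (cong (λ v → ip s z xor (b ∧ v)) e)))
             (cancel-xor c (ip s z) (b ∧ d)))
      (eq a s e)

  -- Exactly one leading bit a solves a xor e = d, so summing over a leaves a single copy of c. The
  -- two summands are written in the form to which `ip` unfolds.
  pivot : ∀ d e (g : Bool → ℕ) c → (∀ a → a xor e ≡ d → g a ≡ c) →
          matches (just d) ((false ∧ true) xor e) * g false
            + matches (just d) ((true ∧ true) xor e) * g true ≡ c
  pivot false false g c h = trans (+-identityʳ _) (trans (+-identityʳ _) (h false refl))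
  pivot false true  g c h = trans (+-identityʳ _) (h true refl)
  pivot true  false g c h = trans (+-identityʳ _) (h true refl)
  pivot true  true  g c h = trans (+-identityʳ _) (trans (+-identityʳ _) (h false refl))

  -- A prescription on the pivot vector determines the leading bit of s, which yields the extra
  -- factor 1/2; the prescriptions on xs then become prescriptions on zs.
  independent-pivot : ∀ {n r} y {xs : Vec (Vec Bool (suc n)) r} {zs : Vec (Vec Bool n) r} →
                      Pointwise (Lifts y) xs zs → Independent zs → Independent ((true ∷ y) ∷ xs)
  independent-pivot {n} y {xs} {zs} ls ind (just d ∷ cs) with shift y ls d cs
  ... | cs′ , # , eq = begin
    ∑ (cube (suc n)) f * 2 ^ (1 + #defined cs)
      ≡⟨ cong (_* 2 ^ (1 + #defined cs)) (trans (∑-cube-suc n f) (sym (∑-+ (cube n) _ _))) ⟩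
    ∑ (cube n) (λ s → f (false ∷ s) + f (true ∷ s)) * 2 ^ (1 + #defined cs)
      ≡⟨ cong₂ (λ u v → u * 2 ^ (1 + v))
           (∑-cong (cube n) (λ s → pivot d (ip s y) (λ a → satisfies (a ∷ s) xs cs) _ (λ a → eq a s)))
           (sym #) ⟩
    ∑ (cube n) (λ s → satisfies s zs cs′) * (2 * 2 ^ #defined cs′)
      ≡⟨ x*2y (∑ (cube n) (λ s → satisfies s zs cs′)) (2 ^ #defined cs′) ⟩
    2 * (∑ (cube n) (λ s → satisfies s zs cs′) * 2 ^ #defined cs′)
      ≤⟨ *-monoʳ-≤ 2 (ind cs′) ⟩
    2 * 2 ^ n ∎
    where
    open ≤-Reasoning
    f : Vec Bool (suc n) → ℕ
    f s = satisfies s ((true ∷ y) ∷ xs) (just d ∷ cs)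
    x*2y : ∀ u v → u * (2 * v) ≡ 2 * (u * v)
    x*2y u v = trans (sym (*-assoc u 2 v)) (trans (cong (_* v) (*-comm u 2)) (*-assoc 2 u v))
  -- Without a prescription on the pivot, the two possible values are added up; the previous clause
  -- bounds each by half of the total.
  independent-pivot {n} y {xs} {zs} ls ind (nothing ∷ cs) = begin
    ∑ (cube (suc n)) (λ s → 1 * satisfies s xs cs) * P
      ≡⟨ cong (_* P) (trans (∑-cong (cube (suc n)) split) (∑-+ (cube (suc n)) (f false) (f true))) ⟩
    (∑ (cube (suc n)) (f false) + ∑ (cube (suc n)) (f true)) * P
      ≡⟨ *-distribʳ-+ P (∑ (cube (suc n)) (f false)) _ ⟩
    ∑ (cube (suc n)) (f false) * P + ∑ (cube (suc n)) (f true) * P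
      ≤⟨ +-mono-≤ (halve false) (halve true) ⟩
    2 ^ n + 2 ^ n
      ≡⟨ cong (2 ^ n +_) (sym (+-identityʳ (2 ^ n))) ⟩
    2 * 2 ^ n ∎
    where
    open ≤-Reasoning
    P : ℕ
    P = 2 ^ #defined cs
    f : Bool → Vec Bool (suc n) → ℕ
    f d s = satisfies s ((true ∷ y) ∷ xs) (just d ∷ cs)
    split : ∀ s → 1 * satisfies s xs cs ≡ f false s + f true s
    split s with ip s (true ∷ y)
    ... | false = sym (+-identityʳ _)
    ... | true  = refl
    halve : ∀ d → ∑ (cube (suc n)) (f d) * P ≤ 2 ^ n
    halve d = *-cancelˡ-≤ 2 (begin
      2 * (∑ (cube (suc n)) (f d) * P)   ≡⟨ sym (*-assoc 2 (∑ (cube (suc n)) (f d)) P) ⟩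
      2 * ∑ (cube (suc n)) (f d) * P     ≡⟨ cong (_* P) (*-comm 2 (∑ (cube (suc n)) (f d))) ⟩
      ∑ (cube (suc n)) (f d) * 2 * P     ≡⟨ *-assoc (∑ (cube (suc n)) (f d)) 2 P ⟩
      ∑ (cube (suc n)) (f d) * (2 * P)   ≤⟨ independent-pivot y {xs} {zs} ls ind (just d ∷ cs) ⟩
      2 * 2 ^ n                          ∎)

  independent-map-false : ∀ {n r} {zs : Vec (Vec Bool n) r} →
                          Independent zs → Independent (Vec.map (false ∷_) zs)
  independent-map-false {n} {zs = zs} ind cs = begin
    ∑ (cube (suc n)) f * 2 ^ #defined cs
      ≡⟨ cong (_* 2 ^ #defined cs) (∑-cube-suc n f) ⟩
    (∑ (cube n) (λ s → f (false ∷ s)) + ∑ (cube n) (λ s → f (true ∷ s))) * 2 ^ #defined cs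
      ≡⟨ cong (_* 2 ^ #defined cs) (cong₂ _+_ (∑-cong (cube n) (λ s → drop-head false s zs cs))
                                              (∑-cong (cube n) (λ s → drop-head true s zs cs))) ⟩
    (F + F) * 2 ^ #defined cs
      ≡⟨ *-distribʳ-+ (2 ^ #defined cs) F F ⟩
    F * 2 ^ #defined cs + F * 2 ^ #defined cs
      ≤⟨ +-mono-≤ (ind cs) (ind cs) ⟩
    2 ^ n + 2 ^ n
      ≡⟨ cong (2 ^ n +_) (sym (+-identityʳ (2 ^ n))) ⟩
    2 * 2 ^ n ∎
    where
    open ≤-Reasoning
    F : ℕ
    F = ∑ (cube n) (λ s → satisfies s zs cs)
    f : Vec Bool (suc n) → ℕ
    f s = satisfies s (Vec.map (false ∷_) zs) cs
    drop-head : ∀ {r} a s (zs : Vec (Vec Bool n) r) cs →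
                satisfies (a ∷ s) (Vec.map (false ∷_) zs) cs ≡ satisfies s zs cs
    drop-head a s []       []       = refl
    drop-head a s (z ∷ zs) (c ∷ cs) = cong₂ _*_
      (cong (λ u → matches c (u xor ip s z)) (∧-zeroʳ a)) (drop-head a s zs cs)

  all-map-false : ∀ {n r} {A : Vec Bool (suc n) → Set} {zs : Vec (Vec Bool n) r} →
                  VecAll.All (A ∘ (false ∷_)) zs → VecAll.All A (Vec.map (false ∷_) zs)
  all-map-false []         = []
  all-map-false {A = A} (az ∷ azs) = az ∷ all-map-false {A = A} azs

-- Gaussian elimination. If no vector of A starts with `true`, the first coordinate is dropped.
-- Otherwise some `true ∷ y` in A serves as pivot, and the quotient by it retains at least half as
-- many points, enough for r further vectors.
independent-subset : ∀ n r {A : Vec Bool n → Set} (A? : Decidable A) →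
                     2 ^ r ≤ ∑ (cube n) (λ x → 𝟙 (A? x)) →
                     ∃[ xs ] (VecAll.All A {r} xs × Independent xs)
independent-subset n zero A? _ = [] , [] , λ { [] → ≤-reflexive (begin
  ∑ (cube n) (λ _ → 1) * 1 ≡⟨ *-identityʳ _ ⟩
  ∑ (cube n) (λ _ → 1)     ≡⟨ sym (length≡∑1 (cube n)) ⟩
  _                        ≡⟨ length-cube n ⟩
  2 ^ n                    ∎) }
  where open ≡-Reasoning
-- The zero-dimensional cube has one point, too few for 2 ^ suc r.
independent-subset zero (suc r) A? large with ≤-trans (m^n>0 2 r) (+-cancelˡ-≤ 1 _ _ (begin
  1 + 2 ^ r                 ≤⟨ +-monoˡ-≤ (2 ^ r) (m^n>0 2 r) ⟩
  2 ^ r + 2 ^ r             ≡⟨ cong (2 ^ r +_) (sym (+-identityʳ (2 ^ r))) ⟩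
  2 ^ suc r                 ≤⟨ large ⟩
  𝟙 (A? []) + 0             ≤⟨ +-monoˡ-≤ 0 (𝟙≤ (A? []) (λ _ → ≤-refl)) ⟩
  1 + 0                     ∎))
  where open ≤-Reasoning
... | ()
independent-subset (suc n) (suc r) {A} A? large
  with ∑-positive (cube n) (λ y → 𝟙 (A? (true ∷ y)))
... | inj₁ none with independent-subset n (suc r) (λ z → A? (false ∷ z)) (begin
  2 ^ suc r                                     ≤⟨ large ⟩
  ∑ (cube (suc n)) (λ x → 𝟙 (A? x))             ≡⟨ ∑-cube-suc n _ ⟩
  ∑ (cube n) (λ z → 𝟙 (A? (false ∷ z))) + ∑ (cube n) (λ z → 𝟙 (A? (true ∷ z)))
                                                ≡⟨ cong (∑ (cube n) (λ z → 𝟙 (A? (false ∷ z))) +_) none ⟩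
  ∑ (cube n) (λ z → 𝟙 (A? (false ∷ z))) + 0     ≡⟨ +-identityʳ _ ⟩
  ∑ (cube n) (λ z → 𝟙 (A? (false ∷ z)))         ∎)
  where open ≤-Reasoning
...   | zs , Azs , ind = Vec.map (false ∷_) zs , all-map-false {A = A} Azs , independent-map-false {zs = zs} ind
independent-subset (suc n) (suc r) {A} A? large
    | inj₂ (y , one) with independent-subset n r fibre? (*-cancelˡ-≤ 2 (begin
  2 * 2 ^ r                                     ≤⟨ large ⟩
  ∑ (cube (suc n)) (λ x → 𝟙 (A? x))             ≡⟨ ∑-cube-suc n _ ⟩
  ∑ (cube n) (λ z → 𝟙 (A? (false ∷ z))) + ∑ (cube n) (λ z → 𝟙 (A? (true ∷ z)))
    -- Re-indexing the second half by the translation places both points of a fibre over the same z.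
    ≡⟨ cong (∑ (cube n) (λ z → 𝟙 (A? (false ∷ z))) +_) (sym (∑-cube-translate n y _)) ⟩
  ∑ (cube n) (λ z → 𝟙 (A? (false ∷ z))) + ∑ (cube n) (λ z → 𝟙 (A? (true ∷ (z ⊕ y))))
    ≤⟨ +-mono-≤ (∑-mono (cube n) (λ z → 𝟙≤ (A? _) (λ a → ≤-reflexive (sym (𝟙-yes (fibre? z) (inj₁ a))))))
                (∑-mono (cube n) (λ z → 𝟙≤ (A? _) (λ a → ≤-reflexive (sym (𝟙-yes (fibre? z) (inj₂ a)))))) ⟩
  ∑ (cube n) (λ z → 𝟙 (fibre? z)) + ∑ (cube n) (λ z → 𝟙 (fibre? z))
    ≡⟨ cong (∑ (cube n) (λ z → 𝟙 (fibre? z)) +_) (sym (+-identityʳ _)) ⟩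
  2 * ∑ (cube n) (λ z → 𝟙 (fibre? z)) ∎))
  where
  open ≤-Reasoning
  fibre? : Decidable (Fibre A y)
  fibre? z = A? (false ∷ z) ⊎-dec A? (true ∷ (z ⊕ y))
...   | zs , Fzs , ind with lift-all A y zs Fzs
...     | xs , Axs , ls = (true ∷ y) ∷ xs , 𝟙-inv (A? _) one ∷ Axs , independent-pivot y {xs} {zs} ls ind

-- Counting pairs with short certificates

matrices : ∀ n m → List (Vec (Vec Bool n) m)
matrices n m = vecs (cube n) m

length-matrices : ∀ n m → length (matrices n m) ≡ (2 ^ n) ^ m
length-matrices n m = trans (length-vecs (cube n) m) (cong (_^ m) (length-cube n))

satisfiesRows : ∀ {n m r} → Vec (Vec Bool n) m → Vec (Vec Bool n) r → (Fin m → Vec (Maybe Bool) r) → ℕ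
satisfiesRows []      xs cs = 1
satisfiesRows (s ∷ S) xs cs = satisfies s xs (cs zero) * satisfiesRows S xs (cs ∘ suc)

-- The rows of S vary independently, so the sum is a product over the rows and the exponents add up.
rows-bound : ∀ {n r} (xs : Vec (Vec Bool n) r) → Independent xs → ∀ m cs →
             ∑ (matrices n m) (λ S → satisfiesRows S xs cs) * 2 ^ ∑ (allFin m) (#defined ∘ cs) ≤ (2 ^ n) ^ m
rows-bound         xs ind zero    cs = ≤-refl
rows-bound {n = n} xs ind (suc m) cs = begin
  ∑ (matrices n (suc m)) (λ S → satisfiesRows S xs cs) * 2 ^ ∑ (allFin (suc m)) (#defined ∘ cs)
    ≡⟨ cong₂ (λ u v → u * 2 ^ v) factor (∑-allFin-suc (#defined ∘ cs)) ⟩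
  (F * G) * 2 ^ (#defined (cs zero) + ∑ (allFin m) (#defined ∘ cs ∘ suc))
    ≡⟨ cong (F * G *_) (^-distribˡ-+-* 2 (#defined (cs zero)) _) ⟩
  (F * G) * (2 ^ #defined (cs zero) * 2 ^ ∑ (allFin m) (#defined ∘ cs ∘ suc))
    ≡⟨ [m*n]*[o*p]≡[m*o]*[n*p] F G (2 ^ #defined (cs zero)) _ ⟩
  (F * 2 ^ #defined (cs zero)) * (G * 2 ^ ∑ (allFin m) (#defined ∘ cs ∘ suc))
    ≤⟨ *-mono-≤ (ind (cs zero)) (rows-bound xs ind m (cs ∘ suc)) ⟩
  2 ^ n * (2 ^ n) ^ m ∎
  where
  open ≤-Reasoning
  F G : ℕ
  F = ∑ (cube n) (λ s → satisfies s xs (cs zero))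
  G = ∑ (matrices n m) (λ S → satisfiesRows S xs (cs ∘ suc))
  factor : ∑ (matrices n (suc m)) (λ S → satisfiesRows S xs cs) ≡ F * G
  factor = trans (∑-vecs-suc (cube n) m _)
    (trans (∑-cong (cube n) (λ s → ∑-*ˡ (matrices n m) (satisfies s xs (cs zero)) (λ S → satisfiesRows S xs (cs ∘ suc)))) (∑-*ʳ (cube n) _ G))

-- A certificate u asserts the values of some of the m products S x (nothing = no claim);
-- it is accepted for (S , x) if it makes at least K claims and all of them are true.
module Certificates (n m K : ℕ) {U : Set} (us : List U) where

  Claims : Set
  Claims = U → Fin m → Maybe Bool

  Informative : Claims → U → Set
  Informative cl u = K ≤ ∑ (allFin m) (defined ∘ cl u)

  Correct : Claims → Vec (Vec Bool n) m → Vec Bool n → U → Set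
  Correct cl S x u = ∀ q → 1 ≤ matches (cl u q) (ip (lookup S q) x)

  Certified : Claims → Vec (Vec Bool n) m → Vec Bool n → Set
  Certified cl S x = Any (λ u → Informative cl u × Correct cl S x u) us

  certified? : ∀ cl S → Decidable (Certified cl S)
  certified? cl S x = any? (λ u → (K ≤? _) ×-dec all? (λ q → 1 ≤? _)) us

  #certified : Claims → Vec (Vec Bool n) m → ℕ
  #certified cl S = ∑ (cube n) (λ x → 𝟙 (certified? cl S x))

  private
    columns : ∀ {r} → Claims → Vec U r → Fin m → Vec (Maybe Bool) r
    columns cl us q = Vec.map (λ u → cl u q) us

    columns-defined : ∀ {r} cl (us : Vec U r) → VecAll.All (Informative cl) us →
                      r * K ≤ ∑ (allFin m) (#defined ∘ columns cl us)
    columns-defined cl []       []         = z≤n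
    columns-defined cl (u ∷ us) (iu ∷ ius) = ≤-trans
      (+-mono-≤ iu (columns-defined cl us ius))
      (≤-reflexive (sym (∑-+ (allFin m) (defined ∘ cl u) (#defined ∘ columns cl us))))

    choose : ∀ {r} cl S (xs : Vec (Vec Bool n) r) → VecAll.All (Certified cl S) xs →
             Σ[ vs ∈ Vec U r ] (VecAll.All (_∈ₗ us) vs × VecAll.All (Informative cl) vs ×
                      Pointwise (λ x u → Correct cl S x u) xs vs)
    choose cl S []       []         = [] , [] , [] , []
    choose cl S (x ∷ xs) (cx ∷ cxs) with find cx | choose cl S xs cxs
    ... | u , u∈ , iu , cu | vs , vs∈ , ivs , cvs = u ∷ vs , u∈ ∷ vs∈ , iu ∷ ivs , cu ∷ cvs

    satisfies-correct : ∀ {r} s (xs : Vec (Vec Bool n) r) cs →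
                        Pointwise (λ x c → 1 ≤ matches c (ip s x)) xs cs → 1 ≤ satisfies s xs cs
    satisfies-correct s []       []       []       = s≤s z≤n
    satisfies-correct s (x ∷ xs) (c ∷ cs) (h ∷ hs) = *-mono-≤ h (satisfies-correct s xs cs hs)

    rows-correct : ∀ {l r} (S : Vec (Vec Bool n) l) (xs : Vec (Vec Bool n) r) cs →
                   (∀ q → Pointwise (λ x c → 1 ≤ matches c (ip (lookup S q) x)) xs (cs q)) →
                   1 ≤ satisfiesRows S xs cs
    rows-correct []      xs cs h = s≤s z≤n
    rows-correct (s ∷ S) xs cs h = *-mono-≤ (satisfies-correct s xs (cs zero) (h zero))
                                            (rows-correct S xs (cs ∘ suc) (h ∘ suc))

    correct-columns : ∀ {r} cl S {xs : Vec (Vec Bool n) r} {vs : Vec U r} →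
                      Pointwise (λ x u → Correct cl S x u) xs vs →
                      ∀ q → Pointwise (λ x c → 1 ≤ matches c (ip (lookup S q) x)) xs (columns cl vs q)
    correct-columns cl S []       q = []
    correct-columns cl S (c ∷ cs) q = c q ∷ correct-columns cl S cs q

  -- If 2 ^ r vectors are certified for S, then r independent ones among them, with their
  -- certificates, prescribe at least r K products, which a 2^-(r K) fraction of the matrices can
  -- satisfy. The union bound runs over all r-tuples of vectors and of certificates.
  heavy-bound : ∀ r cl →
    ∑ (matrices n m) (λ S → 𝟙 (2 ^ r ≤? #certified cl S)) * 2 ^ (r * K)
      ≤ ((2 ^ n) ^ r * length us ^ r) * (2 ^ n) ^ m
  heavy-bound r cl = subst (λ l → ∑ (matrices n m) (λ S → 𝟙 (2 ^ r ≤? #certified cl S)) * 2 ^ (r * K) ≤ l * (2 ^ n) ^ m)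
      (trans (length-cartesianProduct (vecs (cube n) r) (vecs us r))
             (cong₂ _*_ (length-matrices n r) (length-vecs us r)))
      (cover-bound (matrices n m) (cartesianProduct (vecs (cube n) r) (vecs us r)) (2 ^ (r * K)) cover fibre)
    where
    open ≤-Reasoning
    Good : Vec (Vec Bool n) r × Vec U r → Set
    Good (xs , vs) = Independent xs × VecAll.All (Informative cl) vs
    good? : Decidable Good
    good? (xs , vs) = independent? xs ×-dec VecAll.all? (λ u → K ≤? _) vs
    g : Vec (Vec Bool n) r × Vec U r → Vec (Vec Bool n) m → ℕ
    g (xs , vs) S = 𝟙 (good? (xs , vs)) * satisfiesRows S xs (columns cl vs)

    cover : ∀ S → 𝟙 (2 ^ r ≤? #certified cl S) ≤ ∑ (cartesianProduct (vecs (cube n) r) (vecs us r)) (λ y → g y S)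
    cover S = 𝟙≤ (2 ^ r ≤? #certified cl S) (witness S)
      where
      witness : ∀ S → 2 ^ r ≤ #certified cl S → 1 ≤ ∑ (cartesianProduct (vecs (cube n) r) (vecs us r)) (λ y → g y S)
      witness S heavy with independent-subset n r (certified? cl S) heavy
      ... | xs , cxs , ind with choose cl S xs cxs
      ...   | vs , vs∈ , ivs , cvs = begin
        1                        ≤⟨ *-mono-≤ (≤-reflexive (sym (𝟙-yes (good? (xs , vs)) (ind , ivs))))
                                             (rows-correct S xs (columns cl vs) (correct-columns cl S cvs)) ⟩
        g (xs , vs) S            ≤⟨ ∈⇒≤∑ (λ y → g y S) (∈-cartesianProduct⁺ (∈-vecs-full ∈-cube xs) (∈-vecs vs∈)) ⟩
        _                        ∎

    fibre : ∀ y → ∑ (matrices n m) (g y) * 2 ^ (r * K) ≤ (2 ^ n) ^ m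
    fibre (xs , vs) = gated-bound (matrices n m) (good? (xs , vs)) (λ S → satisfiesRows S xs (columns cl vs)) λ (ind , ivs) → begin
      ∑ (matrices n m) (λ S → satisfiesRows S xs (columns cl vs)) * 2 ^ (r * K)
        ≤⟨ *-monoʳ-≤ (∑ (matrices n m) (λ S → satisfiesRows S xs (columns cl vs))) (^-monoʳ-≤ 2 (columns-defined cl vs ivs)) ⟩
      ∑ (matrices n m) (λ S → satisfiesRows S xs (columns cl vs)) * 2 ^ ∑ (allFin m) (#defined ∘ columns cl vs)
        ≤⟨ rows-bound xs ind m (columns cl vs) ⟩
      (2 ^ n) ^ m ∎

  -- Here the claims may also depend on an advice string a, over which we union bound,
  -- and on a transcript determined by a and S alone.
  pairs-bound : ∀ {Ad Tr : Set} (as : List Ad) (ts : List Tr) (cl : Ad → Tr → Claims)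
                (transcript : Ad → Vec (Vec Bool n) m → Tr) → (∀ a S → transcript a S ∈ₗ ts) → ∀ r →
    ∑ (matrices n m) (λ S → ∑ (cube n) (λ x → ∑ as (λ a → 𝟙 (certified? (cl a (transcript a S)) S x)))) * 2 ^ (r * K)
      ≤ length as * ((2 ^ n) ^ m * 2 ^ r * 2 ^ (r * K)
                     + length ts * ((2 ^ n) ^ r * length us ^ r * (2 ^ n) ^ m) * 2 ^ n)
  pairs-bound as ts cl transcript t∈ r =
    cover-bound (matrices n m) as {g = λ a S → #certified (cl a (transcript a S)) S} (2 ^ (r * K))
      (λ S → ≤-reflexive (∑-swap (cube n) as _)) per-advice
    where
    open ≤-Reasoning
    e : ℕ
    e = 2 ^ (r * K)
    per-advice : ∀ a → ∑ (matrices n m) (λ S → #certified (cl a (transcript a S)) S) * e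
                       ≤ (2 ^ n) ^ m * 2 ^ r * e + length ts * ((2 ^ n) ^ r * length us ^ r * (2 ^ n) ^ m) * 2 ^ n
    per-advice a = begin
      ∑ (matrices n m) (λ S → #certified (cl a (transcript a S)) S) * e
        ≤⟨ *-monoˡ-≤ e (∑-mono (matrices n m) per-matrix) ⟩
      ∑ (matrices n m) (λ S → 2 ^ r + ∑ ts (λ t → heavy t S) * 2 ^ n) * e
        ≡⟨ cong (_* e) (∑-+ (matrices n m) _ _) ⟩
      (∑ (matrices n m) (λ _ → 2 ^ r) + ∑ (matrices n m) (λ S → ∑ ts (λ t → heavy t S) * 2 ^ n)) * e
        ≡⟨ *-distribʳ-+ e (∑ (matrices n m) (λ _ → 2 ^ r)) _ ⟩
      ∑ (matrices n m) (λ _ → 2 ^ r) * e + ∑ (matrices n m) (λ S → ∑ ts (λ t → heavy t S) * 2 ^ n) * e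
        ≡⟨ cong₂ (λ u v → u * e + v * e)
             (trans (∑-const (matrices n m) (2 ^ r)) (cong (_* 2 ^ r) (length-matrices n m)))
             (∑-*ʳ (matrices n m) _ (2 ^ n)) ⟩
      (2 ^ n) ^ m * 2 ^ r * e + H * 2 ^ n * e
        ≡⟨ cong ((2 ^ n) ^ m * 2 ^ r * e +_)
             (trans (*-assoc H (2 ^ n) e) (trans (cong (H *_) (*-comm (2 ^ n) e)) (sym (*-assoc H e (2 ^ n))))) ⟩
      (2 ^ n) ^ m * 2 ^ r * e + H * e * 2 ^ n
        ≤⟨ +-monoʳ-≤ ((2 ^ n) ^ m * 2 ^ r * e) (*-monoˡ-≤ (2 ^ n)
             (cover-bound (matrices n m) ts {g = heavy} e (λ S → ≤-refl) (λ t → heavy-bound r (cl a t)))) ⟩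
      (2 ^ n) ^ m * 2 ^ r * e + length ts * ((2 ^ n) ^ r * length us ^ r * (2 ^ n) ^ m) * 2 ^ n ∎
      where
      heavy : _ → Vec (Vec Bool n) m → ℕ
      heavy t S = 𝟙 (2 ^ r ≤? #certified (cl a t) S)
      H : ℕ
      H = ∑ (matrices n m) (λ S → ∑ ts (λ t → heavy t S))
      -- A light matrix contributes less than 2 ^ r, a heavy one at most 2 ^ n. Heaviness is summed
      -- over all transcripts because the actual one depends on S, whereas `heavy-bound` requires
      -- claims fixed beforehand.
      per-matrix : ∀ S → #certified (cl a (transcript a S)) S ≤ 2 ^ r + ∑ ts (λ t → heavy t S) * 2 ^ n
      per-matrix S with 2 ^ r ≤? #certified (cl a (transcript a S)) S
      ... | no light = ≤-trans (<⇒≤ (≰⇒> light)) (m≤m+n (2 ^ r) _)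
      ... | yes isHeavy = begin
        #certified (cl a (transcript a S)) S       ≤⟨ ∑-bound (cube n) (λ x → 𝟙≤ (certified? _ S x) (λ _ → ≤-refl)) ⟩
        length (cube n) * 1                        ≡⟨ trans (*-identityʳ _) (length-cube n) ⟩
        2 ^ n                                      ≡⟨ sym (*-identityˡ (2 ^ n)) ⟩
        1 * 2 ^ n                                  ≤⟨ *-monoˡ-≤ (2 ^ n) (≤-trans (≤-reflexive (sym (𝟙-yes (2 ^ r ≤? _) isHeavy)))
                                                        (∈⇒≤∑ (λ t → heavy t S) (t∈ a S))) ⟩
        ∑ ts (λ t → heavy t S) * 2 ^ n             ≤⟨ m≤n+m _ (2 ^ r) ⟩
        2 ^ r + ∑ ts (λ t → heavy t S) * 2 ^ n     ∎

-- Simulated queries and logged updates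

_≟ʷ_ : ∀ {w} (a b : Word w) → Dec (a ≡ b)
_≟ʷ_ = ≡-dec _≟ᵇ_

after : ∀ {w A} → Prog w A → Memory w → Memory w
after p M = proj₁ (proj₂ (run p M))

cost : ∀ {w A} → Prog w A → Memory w → ℕ
cost p M = proj₂ (proj₂ (run p M))

-- Padded with the zero address; false stands in for the answer when the k probes run out.
simulate : ∀ {w} k → Prog w Bool → Memory w → Vec (Word w) k × Bool
simulate zero    (done b)      M = [] , b
simulate zero    (read a f)    M = [] , false
simulate zero    (write a v p) M = [] , false
simulate (suc k) (done b)      M = replicate _ (replicate _ false) , b
simulate (suc k) (read a f)    M = a ∷ proj₁ (simulate k (f (M a)) M) , proj₂ (simulate k (f (M a)) M)
simulate (suc k) (write a v p) M =
  replicate _ false ∷ proj₁ (simulate k p (writeMem a v M)) , proj₂ (simulate k p (writeMem a v M))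

-- Agreement on the first cell read makes both runs continue with the same subprogram, and a write
-- alters both memories alike; so adaptivity does no harm and only the trace matters.
simulate-agree : ∀ {w} k p (M M′ : Memory w) →
                 (∀ a → a ∈ proj₁ (simulate k p M) → M′ a ≡ M a) → simulate k p M′ ≡ simulate k p M
simulate-agree zero    (done b)      M M′ h = refl
simulate-agree zero    (read a f)    M M′ h = refl
simulate-agree zero    (write a v p) M M′ h = refl
simulate-agree (suc k) (done b)      M M′ h = refl
simulate-agree (suc k) (read a f)    M M′ h rewrite h a (here refl) =
  cong (λ s → a ∷ proj₁ s , proj₂ s) (simulate-agree k (f (M a)) M M′ (λ a′ a′∈ → h a′ (there a′∈)))
simulate-agree (suc k) (write a v p) M M′ h =
  cong (λ s → replicate _ false ∷ proj₁ s , proj₂ s)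
    (simulate-agree k p (writeMem a v M) (writeMem a v M′)
      (λ a′ a′∈ → cong (λ u → if does (≡-dec _≟ᵇ_ a′ a) then v else u) (h a′ (there a′∈))))

simulate-correct : ∀ {w} k p (M : Memory w) → cost p M ≤ k → proj₂ (simulate k p M) ≡ proj₁ (run p M)
simulate-correct zero    (done b) M le = refl
simulate-correct (suc k) (done b) M le = refl
simulate-correct zero (read a f) M le with run (f (M a)) M
simulate-correct zero (read a f) M () | _
simulate-correct zero (write a v p) M le with run p (writeMem a v M)
simulate-correct zero (write a v p) M () | _
simulate-correct (suc k) (read a f) M le with run (f (M a)) M | simulate-correct k (f (M a)) M
... | _ | ih = ih (s≤s⁻¹ le)
simulate-correct (suc k) (write a v p) M le with run p (writeMem a v M) | simulate-correct k p (writeMem a v M)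
... | _ | ih = ih (s≤s⁻¹ le)

-- A superset of the addresses written, because of the padding.
writes : ∀ {w A} k → Prog w A → Memory w → Vec (Word w) k
writes zero    p             M = []
writes (suc k) (done x)      M = replicate _ (replicate _ false)
writes (suc k) (read a f)    M = replicate _ false ∷ writes k (f (M a)) M
writes (suc k) (write a v p) M = a ∷ writes k p (writeMem a v M)

writeMem-other : ∀ {w} (a v : Word w) M {a′} → ¬ a′ ≡ a → writeMem a v M a′ ≡ M a′
writeMem-other a v M {a′} a′≢a with a′ ≟ʷ a
... | yes a′≡a = contradiction a′≡a a′≢a
... | no _     = refl

writes-unchanged : ∀ {w A} k (p : Prog w A) M {a} → cost p M ≤ k → ¬ a ∈ writes k p M → after p M a ≡ M a
writes-unchanged k       (done x)   M le a∉ = refl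
writes-unchanged zero    (read a f) M le a∉ with run (f (M a)) M
writes-unchanged zero    (read a f) M () a∉ | _
writes-unchanged zero    (write a v p) M le a∉ with run p (writeMem a v M)
writes-unchanged zero    (write a v p) M () a∉ | _
writes-unchanged (suc k) (read a f) M le a∉ with run (f (M a)) M | writes-unchanged k (f (M a)) M
... | _ | ih = ih (s≤s⁻¹ le) (a∉ ∘ there)
writes-unchanged (suc k) (write a v p) M le a∉
  with run p (writeMem a v M) | writes-unchanged k p (writeMem a v M)
... | _ | ih = trans (ih (s≤s⁻¹ le) (a∉ ∘ there)) (writeMem-other a v M (a∉ ∘ here))

-- The unknown bits are set to `false` instead of being cut off, so that the result can be fed to
-- the same update procedure.
truncate : ∀ {n} → ℕ → Vec Bool n → Vec Bool n
truncate zero    x       = replicate _ false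
truncate (suc e) []      = []
truncate (suc e) (b ∷ x) = b ∷ truncate e x

truncations : ℕ → ∀ n → List (Vec Bool n)
truncations zero    n       = replicate _ false ∷ []
truncations (suc e) zero    = [] ∷ []
truncations (suc e) (suc n) = concatMap (λ b → map (b ∷_) (truncations e n)) bits

∈-truncations : ∀ {n} e (x : Vec Bool n) → truncate e x ∈ₗ truncations e n
∈-truncations zero    x       = here refl
∈-truncations (suc e) []      = here refl
∈-truncations (suc e) (b ∷ x) = ∈-concat⁺′ (∈-map⁺ (b ∷_) (∈-truncations e x))
  (∈-map⁺ (λ b′ → map (b′ ∷_) (truncations e _)) (∈-bits b))

length-truncations : ∀ e n → length (truncations e n) ≤ 2 ^ e
length-truncations zero    n       = ≤-refl
length-truncations (suc e) zero    = m^n>0 2 (suc e)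
length-truncations (suc e) (suc n) = begin
  length (truncations (suc e) (suc n))       ≡⟨ length≡∑1 (truncations (suc e) (suc n)) ⟩
  ∑ (truncations (suc e) (suc n)) (λ _ → 1)  ≡⟨ ∑-concatMap (λ b → map (b ∷_) (truncations e n)) bits (λ _ → 1) ⟩
  ∑ bits (λ b → ∑ (map (b ∷_) (truncations e n)) (λ _ → 1))
                                             ≡⟨ ∑-cong bits (λ b → trans (∑-map (b ∷_) (truncations e n) (λ _ → 1))
                                                                         (sym (length≡∑1 (truncations e n)))) ⟩
  ∑ bits (λ _ → length (truncations e n))    ≤⟨ ∑-bound bits (λ _ → length-truncations e n) ⟩
  2 * 2 ^ e                                  ∎
  where open ≤-Reasoning

lookup-truncate : ∀ {n} e (x : Vec Bool n) i → toℕ i < e → lookup (truncate e x) i ≡ lookup x i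
lookup-truncate (suc e) (b ∷ x) zero    _         = refl
lookup-truncate (suc e) (b ∷ x) (suc i) (s≤s i<e) = lookup-truncate e x i i<e

take-allFin : ∀ n e → ListAll.All (λ i → toℕ i < e) (take e (allFin n))
take-allFin n e = go e 0 (λ i → i) (λ _ → refl)
  where
  -- The offset c is needed for the induction, since the tail of `allFin` is a `tabulate` starting
  -- later.
  go : ∀ {k} e c (f : Fin k → Fin n) → (∀ j → toℕ (f j) ≡ c + toℕ j) →
       ListAll.All (λ i → toℕ i < c + e) (take e (tabulate f))
  go {zero}  zero    c f h = []
  go {zero}  (suc e) c f h = []
  go {suc k} zero    c f h = []
  go {suc k} (suc e) c f h =
    subst (_< c + suc e) (sym (h zero)) (+-monoʳ-< c (s≤s z≤n))
    ∷ subst (λ d → ListAll.All (λ i → toℕ i < d) (take e (tabulate (f ∘ suc)))) (sym (+-suc c e))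
        (go e (suc c) (f ∘ suc) (λ j → trans (h (suc j)) (+-suc c (toℕ j))))

-- Runs of the update sequence and their logs

module Updates {n m w : ℕ} (ds : DataStructure n m w) (tu : ℕ) where
  open DataStructure ds

  final : Vec Bool n → List (Fin n) → Memory w → Memory w
  final x is M = proj₁ (runUpdates ds x is M)

  worst : Vec Bool n → List (Fin n) → Memory w → ℕ
  worst x is M = proj₂ (runUpdates ds x is M)

  step : Vec Bool n → Fin n → Memory w → Memory w
  step x i = after (update i (lookup x i))

  final-∷ : ∀ x i is M → final x (i ∷ is) M ≡ final x is (step x i M)
  final-∷ x i is M with run (update i (lookup x i)) M
  ... | _ , M′ , _ with runUpdates ds x is M′
  ...   | _ = refl

  worst-∷ : ∀ x i is M → worst x (i ∷ is) M ≡ cost (update i (lookup x i)) M ⊔ worst x is (step x i M)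
  worst-∷ x i is M with run (update i (lookup x i)) M
  ... | _ , M′ , _ with runUpdates ds x is M′
  ...   | _ = refl

  logs : Vec Bool n → List (Fin n) → Memory w → List (Vec (Word w) tu)
  logs x []       M = []
  logs x (i ∷ is) M = writes tu (update i (lookup x i)) M ∷ logs x is (step x i M)

  length-logs : ∀ x is M → length (logs x is M) ≡ length is
  length-logs x []       M = refl
  length-logs x (i ∷ is) M = cong suc (length-logs x is (step x i M))

  logs-unchanged : ∀ x is M {a} → worst x is M ≤ tu → ListAll.All (λ l → ¬ a ∈ l) (logs x is M) →
                   final x is M a ≡ M a
  logs-unchanged x []       M le []       = refl
  logs-unchanged x (i ∷ is) M le (∉l ∷ ∉ls) rewrite final-∷ x i is M | worst-∷ x i is M = trans
    (logs-unchanged x is (step x i M) (≤-trans (m≤n⊔m (cost p M) _) le) ∉ls)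
    (writes-unchanged tu p M (≤-trans (m≤m⊔n (cost p M) _) le) ∉l)
    where p = update i (lookup x i)

  drop-logs : ∀ x e is M → drop e (logs x is M) ≡ logs x (drop e is) (final x (take e is) M)
  drop-logs x zero    is       M = refl
  drop-logs x (suc e) []       M = refl
  drop-logs x (suc e) (i ∷ is) M rewrite final-∷ x i (take e is) M = drop-logs x e is (step x i M)

  final-split : ∀ x e is M → final x is M ≡ final x (drop e is) (final x (take e is) M)
  final-split x zero    is       M = refl
  final-split x (suc e) []       M = refl
  final-split x (suc e) (i ∷ is) M rewrite final-∷ x i (take e is) M | final-∷ x i is M =
    final-split x e is (step x i M)

  worst-drop : ∀ x e is M → worst x (drop e is) (final x (take e is) M) ≤ worst x is M
  worst-drop x zero    is       M = ≤-refl
  worst-drop x (suc e) []       M = ≤-refl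
  worst-drop x (suc e) (i ∷ is) M rewrite final-∷ x i (take e is) M | worst-∷ x i is M =
    ≤-trans (worst-drop x e is (step x i M)) (m≤n⊔m (cost (update i (lookup x i)) M) _)

  final-cong : ∀ x y is M → ListAll.All (λ i → lookup x i ≡ lookup y i) is → final x is M ≡ final y is M
  final-cong x y []       M []       = refl
  final-cong x y (i ∷ is) M (e ∷ es) rewrite final-∷ x i is M | final-∷ y i is M | e =
    final-cong x y is (after (update i (lookup y i)) M) es

-- Certificates from one epoch

span : ∀ {A : Set} {k} → (ℕ → Vec A k) → ∀ N → Vec A (N * k)
span g N = concat (Vec.tabulate {n = N} (g ∘ toℕ))

∈-concat : ∀ {A : Set} {k l} {a : A} {xs : Vec A k} {xss : Vec (Vec A k) l} →
           xs ∈ xss → a ∈ xs → a ∈ concat xss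
∈-concat {a = a} xs∈ a∈ = concat⁺ (VecAny.map (λ eq → subst (a ∈_) eq a∈) xs∈)

∈-span : ∀ {A : Set} {k} {a : A} (g : ℕ → Vec A k) N {τ} → τ < N → a ∈ g τ → a ∈ span g N
∈-span {a = a} g N τ<N a∈ = ∈-concat (∈-tabulate⁺ (g ∘ toℕ) (fromℕ< τ<N))
  (subst (λ τ → a ∈ g τ) (sym (toℕ-fromℕ< τ<N)) a∈)

span⁻ : ∀ {A : Set} {k} {a : A} (g : ℕ → Vec A k) N → a ∈ span g N → ∃[ τ ] (τ < N × a ∈ g τ)
span⁻ g N a∈ with tabulate⁻ (concat⁻ (Vec.tabulate {n = N} (g ∘ toℕ)) a∈)
... | i , a∈g = toℕ i , toℕ<n i , a∈g

overlay : ∀ {w l} → Vec (Word w × Word w) l → Memory w → Memory w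
overlay []            M a = M a
overlay ((b , v) ∷ V) M a with a ≟ʷ b
... | yes _ = v
... | no _  = overlay V M a

-- Repeated addresses are harmless: every entry for an address carries the same content, taken from
-- `M*`.
overlay-∈ : ∀ {w l} (as : Vec (Word w) l) (M* M : Memory w) {a} → a ∈ as →
            overlay (Vec.map (λ b → b , M* b) as) M a ≡ M* a
overlay-∈ (b ∷ as) M* M {a} a∈ with a ≟ʷ b
overlay-∈ (b ∷ as) M* M {a} a∈          | yes refl = refl
overlay-∈ (b ∷ as) M* M {a} (here a≡b)  | no a≢b   = contradiction a≡b a≢b
overlay-∈ (b ∷ as) M* M {a} (there a∈)  | no a≢b   = overlay-∈ as M* M a∈

overlay-∉ : ∀ {w l} (V : Vec (Word w × Word w) l) M {a} → ¬ a ∈ Vec.map proj₁ V → overlay V M a ≡ M a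
overlay-∉ []            M     a∉ = refl
overlay-∉ ((b , v) ∷ V) M {a} a∉ with a ≟ʷ b
... | yes a≡b = contradiction (here a≡b) a∉
... | no _    = overlay-∉ V M (a∉ ∘ there)

entry : ∀ {w k} → List (Vec (Word w) k) → ℕ → Vec (Word w) k
entry []       j       = replicate _ (replicate _ false)
entry (l ∷ ls) zero    = l
entry (l ∷ ls) (suc j) = entry ls j

all-entries : ∀ {w k} {P : Vec (Word w) k → Set} ls → (∀ j → j < length ls → P (entry ls j)) → ListAll.All P ls
all-entries []       h = []
all-entries (l ∷ ls) h = h 0 (s≤s z≤n) ∷ all-entries ls (λ j j< → h (suc j) (s≤s j<))

entry-drop : ∀ {w k} e (ls : List (Vec (Word w) k)) j → entry (drop e ls) j ≡ entry ls (e + j)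
entry-drop zero    ls       j = refl
entry-drop (suc e) []       j = refl
entry-drop (suc e) (l ∷ ls) j = entry-drop e ls j

module Epoch {n m w : ℕ} (ds : DataStructure n m w) (tu tq K : ℕ) (solves : Solves ds tu tq)
             (Z β t : ℕ) where

  open DataStructure ds
  open Updates ds tu

  -- The epoch covers the last N updates, in β blocks of Z; its last block (number 0, counted
  -- from the end) consists of later epochs.
  N : ℕ
  N = β * Z

  -- The bit vector stands for the updates before the epoch. There is one block more than t because
  -- block 0, holding the later epochs, is always included.
  Advice : Set
  Advice = Vec Bool n × Vec (Word w × Word w) (suc t * (Z * tu))

  advices : List Advice
  advices = cartesianProduct (truncations (n ∸ N) n) (vecs (cartesianProduct (cube w) (cube w)) _)

  certificates : List (Vec (Word w) (N * tu))
  certificates = vecs (cube w) _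

  -- Contains all that the claims need to know about S. With advice and transcript fixed the claims
  -- no longer mention S, and the union bound over S applies.
  Transcript : Set
  Transcript = Vec (Vec (Word w) tq × Bool) m

  transcripts : List Transcript
  transcripts = vecs (cartesianProduct (vecs (cube w) tq) bits) m

  early : Vec (Vec Bool n) m → Vec Bool n → Memory w
  early S x = final x (take (n ∸ N) (allFin n)) (preprocess (lookup S))

  transcript : Advice → Vec (Vec Bool n) m → Transcript
  transcript (x , V) S = Vec.tabulate (λ q → simulate tq (query q) (overlay V (early S x)))

  transcript∈ : ∀ a S → transcript a S ∈ₗ transcripts
  transcript∈ a S = ∈-vecs-full (λ (v , b) → ∈-cartesianProduct⁺ (∈-vecs-full ∈-cube v) (∈-bits b)) (transcript a S)

  -- The cells whose simulated content can be trusted: either the advice supplies it, or the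
  -- certificate shows that the cell still has its content from before the epoch.
  Resolved : ∀ {l} → Vec (Word w) l → Vec (Word w) (N * tu) → Word w → Set
  Resolved as u a = a ∈ as ⊎ ¬ a ∈ u

  resolved? : ∀ {l} (as : Vec (Word w) l) u → Decidable (Resolved as u)
  resolved? as u a = (a ∈? as) ⊎-dec ¬? (a ∈? u)
    where open DecMembership _≟ʷ_ using (_∈?_)

  claim : ∀ {l} → Vec (Word w) l → Vec (Word w) (N * tu) → Vec (Word w) tq × Bool → Maybe Bool
  claim as u (trace , answer) = if does (VecAll.all? (resolved? as u) trace) then just answer else nothing

  open Certificates n m K certificates public

  claims : Advice → Transcript → Claims
  claims (x , V) T u q = claim (Vec.map proj₁ V) u (lookup T q)

  module Run (S : Vec (Vec Bool n) m) (x : Vec Bool n) where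

    M₀ M* : Memory w
    M₀ = preprocess (lookup S)
    M* = final x (allFin n) M₀

    -- Time runs backwards, with τ = 0 the last update. From τ = n on, the truncated subtraction
    -- would yield the first log again, hence the guards `τ < n` and `N ≤ n` below.
    writtenAt : ℕ → Vec (Word w) tu
    writtenAt τ = entry (logs x (allFin n) M₀) (n ∸ suc τ)

    certificate : Vec (Word w) (N * tu)
    certificate = span writtenAt N

    block : ℕ → Vec (Word w) (Z * tu)
    block b = span (λ y → writtenAt (b * Z + y)) Z

    known : Vec ℕ t → Vec (Word w) (suc t * (Z * tu))
    known bs = concat (Vec.map block (0 ∷ bs))

    advice : Vec ℕ t → Advice
    advice bs = truncate (n ∸ N) x , Vec.map (λ a → a , M* a) (known bs)

    query-trace : Fin m → Vec (Word w) tq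
    query-trace q = proj₁ (simulate tq (query q) M*)

    module _ (N≤n : N ≤ n) where

      private
        e : ℕ
        e = n ∸ N

        early-truncate : early S (truncate e x) ≡ early S x
        early-truncate = final-cong (truncate e x) x (take e (allFin n)) M₀
          (ListAll.map (λ {i} → lookup-truncate e x i) (take-allFin n e))

        -- Position e + j from the front is time n ∸ suc (e + j) from the back, and this is below N
        -- because e = n ∸ N.
        not-late : ∀ {a} → ¬ a ∈ certificate → ListAll.All (λ l → ¬ a ∈ l) (drop e (logs x (allFin n) M₀))
        not-late {a} a∉ = all-entries (drop e L) λ j j< → subst (λ l → ¬ a ∈ l) (sym (entry-drop e L j))
          (λ a∈ → a∉ (∈-span writtenAt N {n ∸ suc (e + j)} (late (j<N j<)) (subst (λ i → a ∈ entry L i) (sym (back (j<N j<))) a∈)))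
          where
          L = logs x (allFin n) M₀
          length-L : length L ≡ n
          length-L = trans (length-logs x (allFin n) M₀) (Listₚ.length-tabulate id)
          j<N : ∀ {j} → j < length (drop e L) → j < N
          j<N = subst (_ <_) (trans (Listₚ.length-drop e L) (trans (cong (_∸ e) length-L) (m∸[m∸n]≡n N≤n)))
          e+j<n : ∀ {j} → j < N → e + j < n
          e+j<n j<N = <-≤-trans (+-monoʳ-< e j<N) (≤-reflexive (m∸n+n≡m N≤n))
          late : ∀ {j} → j < N → n ∸ suc (e + j) < N
          late {j} j<N = +-cancelʳ-< (suc (e + j)) _ _ (begin-strict
            (n ∸ suc (e + j)) + suc (e + j)  ≡⟨ m∸n+n≡m (e+j<n j<N) ⟩
            n                                ≡⟨ sym (m∸n+n≡m N≤n) ⟩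
            e + N                            ≡⟨ +-comm e N ⟩
            N + e                            <⟨ +-monoʳ-< N (s≤s (m≤m+n e j)) ⟩
            N + suc (e + j)                  ∎)
            where open ≤-Reasoning
          back : ∀ {j} → j < N → n ∸ suc (n ∸ suc (e + j)) ≡ e + j
          back {j} j<N = begin
            n ∸ suc (n ∸ suc (e + j)) ≡⟨ cong (n ∸_) (sym (+-∸-assoc 1 (e+j<n j<N))) ⟩
            n ∸ (n ∸ (e + j))         ≡⟨ m∸[m∸n]≡n (<⇒≤ (e+j<n j<N)) ⟩
            e + j                     ∎
            where open ≡-Reasoning

        -- No update from the epoch on writes such a cell, and the updates before it see only the
        -- first e bits of x. The query index serves to instantiate `solves`, which states the
        -- update bound once per query.
        unwritten : Fin m → ∀ {a} → ¬ a ∈ certificate → M* a ≡ early S (truncate e x) a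
        unwritten q {a} a∉ = begin
          M* a                                               ≡⟨ cong (λ M → M a) (final-split x e (allFin n) M₀) ⟩
          final x (drop e (allFin n)) (early S x) a          ≡⟨ logs-unchanged x (drop e (allFin n)) (early S x)
                                                                  (≤-trans (worst-drop x e (allFin n) M₀) (proj₁ (solves (lookup S) x q)))
                                                                  (subst (ListAll.All _) (drop-logs x e (allFin n) M₀) (not-late a∉)) ⟩
          early S x a                                        ≡⟨ cong (λ M → M a) (sym early-truncate) ⟩
          early S (truncate e x) a                           ∎
          where
          open ≡-Reasoning

        addresses : ∀ bs → Vec.map proj₁ (proj₂ (advice bs)) ≡ known bs
        addresses bs = trans (sym (map-∘ proj₁ (λ a → a , M* a) (known bs))) (map-id (known bs))

        known-content : Fin m → ∀ bs {a} → Resolved (known bs) certificate a →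
                        overlay (proj₂ (advice bs)) (early S (truncate e x)) a ≡ M* a
        known-content q bs     (inj₁ a∈) = overlay-∈ (known bs) M* _ a∈
        known-content q bs {a} (inj₂ a∉) with DecMembership._∈?_ _≟ʷ_ a (known bs)
        ... | yes a∈   = overlay-∈ (known bs) M* _ a∈
        ... | no a∉known = trans
          (overlay-∉ (proj₂ (advice bs)) (early S (truncate e x)) (subst (λ as → ¬ a ∈ as) (sym (addresses bs)) a∉known))
          (sym (unwritten q a∉))

        overlaid : Vec ℕ t → Memory w
        overlaid bs = overlay (proj₂ (advice bs)) (early S (truncate e x))

        claim≡ : ∀ bs q → claims (advice bs) (transcript (advice bs) S) certificate q
                          ≡ claim (known bs) certificate (simulate tq (query q) (overlaid bs))
        claim≡ bs q = cong₂ (λ as r → claim as certificate r) (addresses bs)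
          (lookup∘tabulate (λ q → simulate tq (query q) (overlaid bs)) q)

        answer : ∀ q → proj₂ (simulate tq (query q) M*) ≡ ip (lookup S q) x
        answer q with solves (lookup S) x q
        ... | _ , out , cq = trans (simulate-correct tq (query q) M* cq) out

        -- The claim sees the trace of the simulation only. If all of it is resolved, the true
        -- memory agrees along this trace, so the real query takes the same path and gives the same
        -- answer.
        claim-sound : ∀ bs q → 1 ≤ matches (claim (known bs) certificate (simulate tq (query q) (overlaid bs))) (ip (lookup S q) x)
        claim-sound bs q with VecAll.all? (resolved? (known bs) certificate) (proj₁ (simulate tq (query q) (overlaid bs)))
        ... | no _  = s≤s z≤n
        ... | yes r = ≤-reflexive (sym (𝟙-yes (_ ≟ᵇ _) (trans (cong proj₂ (sym agree)) (answer q))))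
          where
          agree : simulate tq (query q) M* ≡ simulate tq (query q) (overlaid bs)
          agree = simulate-agree tq (query q) (overlaid bs) M*
            (λ a a∈ → sym (known-content q bs (VecAll.lookup r a∈)))

      correct : ∀ bs → Correct (claims (advice bs) (transcript (advice bs) S)) S x certificate
      correct bs q = subst (λ c → 1 ≤ matches c (ip (lookup S q) x)) (sym (claim≡ bs q)) (claim-sound bs q)

      -- The reverse transfer: here the real trace is known to be resolved, so the simulation
      -- follows it and passes its own test.
      claimed : ∀ bs q → VecAll.All (Resolved (known bs) certificate) (query-trace q) →
                defined (claims (advice bs) (transcript (advice bs) S) certificate q) ≡ 1
      claimed bs q r = trans (cong defined (trans (claim≡ bs q) (cong (claim (known bs) certificate) agree))) done′
        where
        agree : simulate tq (query q) (overlaid bs) ≡ simulate tq (query q) M*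
        agree = simulate-agree tq (query q) M* (overlaid bs) (λ a a∈ → known-content q bs (VecAll.lookup r a∈))
        done′ : defined (claim (known bs) certificate (simulate tq (query q) M*)) ≡ 1
        done′ with VecAll.all? (resolved? (known bs) certificate) (query-trace q)
        ... | yes _ = refl
        ... | no ¬r = contradiction r ¬r

      certified : ∀ bs → K ≤ ∑ (allFin m) (defined ∘ claims (advice bs) (transcript (advice bs) S) certificate) →
                  1 ≤ ∑ advices (λ a → 𝟙 (certified? (claims a (transcript a S)) S x))
      certified bs K≤ = ≤-trans
        (≤-reflexive (sym (𝟙-yes (certified? (claims (advice bs) (transcript (advice bs) S)) S x)
          (lose (∈-vecs-full ∈-cube certificate) (K≤ , correct bs)))))
        (∈⇒≤∑ (λ a → 𝟙 (certified? (claims a (transcript a S)) S x))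
          (∈-cartesianProduct⁺ (∈-truncations e x)
            (∈-vecs-full (λ (a , v) → ∈-cartesianProduct⁺ (∈-cube a) (∈-cube v)) (proj₂ (advice bs)))))

      -- τ is the time of the last write to a. If τ ≥ N, the certificate does not contain a; if τ <
      -- Z, block 0 does; in between, block τ / Z does, and it is among the chosen ones.
      resolved : .{{_ : NonZero Z}} → ∀ bs {a} τ → (∀ σ → σ < τ → ¬ a ∈ writtenAt σ) → (τ < n → a ∈ writtenAt τ) →
                 (Z ≤ τ → τ < N → τ / Z ∈ bs) → Resolved (known bs) certificate a
      resolved bs {a} τ before at covered with τ <? N
      ... | no τ≮N = inj₂ λ a∈ → let (σ , σ<N , a∈σ) = span⁻ writtenAt N a∈ in before σ (<-≤-trans σ<N (≮⇒≥ τ≮N)) a∈σ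
      ... | yes τ<N with τ <? Z
      ...   | yes τ<Z = inj₁ (∈-concat {xss = Vec.map block (0 ∷ bs)} (here refl) (∈-span writtenAt Z τ<Z (at (<-≤-trans τ<N N≤n))))
      ...   | no τ≮Z = inj₁ (∈-concat {xss = Vec.map block (0 ∷ bs)} (there (∈ᵥ.∈-map⁺ block (covered (≮⇒≥ τ≮Z) τ<N)))
                (∈-span (λ y → writtenAt (τ / Z * Z + y)) Z (m%n<n τ Z)
                  (subst (λ σ → a ∈ writtenAt σ) (trans (m≡m%n+[m/n]*n τ Z) (+-comm (τ % Z) _)) (at (<-≤-trans τ<N N≤n)))))

-- Choosing an epoch and its blocks for each query

light : ∀ {A : Set} (xs : List A) f t → ∑ xs f < length xs * suc t → ∃[ x ] (x ∈ₗ xs × f x ≤ t)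
light (x ∷ xs) f t lt with f x ≤? t
... | yes fx≤t = x , here refl , fx≤t
... | no fx≰t with light xs f t (+-cancelˡ-< (suc t) _ _ (≤-<-trans (+-monoˡ-≤ (∑ xs f) (≰⇒> fx≰t)) lt))
...   | y , y∈ , fy≤t = y , there y∈ , fy≤t

module _ {P : ℕ → Set} (P? : Decidable P) (f : ℕ → ℕ) (β : ℕ) (0<β : 0 < β) (f<β : ∀ x → P x → f x < β) where

  -- The values are padded with 0 to exactly t entries, so that the possible choices are simply the
  -- β ^ t vectors over `upTo β`.
  collect : ∀ (xs : List ℕ) t → ∑ xs (λ x → 𝟙 (P? x)) ≤ t →
            Σ[ bs ∈ Vec ℕ t ] (VecAll.All (_< β) bs × (∀ x → x ∈ₗ xs → P x → f x ∈ bs))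
  collect []       zero    _  = [] , [] , λ _ ()
  collect []       (suc t) le with collect [] t z≤n
  ... | bs , bs<β , _ = 0 ∷ bs , 0<β ∷ bs<β , λ _ ()
  collect (x ∷ xs) t le with P? x
  collect (x ∷ xs) t le | no ¬p with collect xs t le
  ... | bs , bs<β , h = bs , bs<β , λ where
    y (here refl) p → contradiction p ¬p
    y (there y∈)  p → h y y∈ p
  collect (x ∷ xs) (suc t) (s≤s le) | yes p with collect xs t le
  ... | bs , bs<β , h = f x ∷ bs , f<β x p ∷ bs<β , λ where
    y (here refl) p → here refl
    y (there y∈)  p → there (h y y∈ p)

-- A bounded search that returns k itself on failure; a cell that no update logs thus gets a time
-- outside every epoch that fits into the n updates.
firstHit : ∀ {P : ℕ → Set} → Decidable P → ∀ k → ∃[ τ ] ((∀ σ → σ < τ → ¬ P σ) × (τ < k → P τ))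
firstHit P? zero = 0 , (λ _ ()) , λ ()
firstHit P? (suc k) with P? 0
... | yes p0 = 0 , (λ _ ()) , λ _ → p0
... | no ¬p0 with firstHit (P? ∘ suc) k
...   | τ , before , at = suc τ , (λ { zero _ → ¬p0 ; (suc σ) (s≤s σ<τ) → before σ σ<τ }) , λ { (s≤s τ<k) → at τ<k }

𝟙-disjoint : ∀ {P Q R : Set} (P? : Dec P) (Q? : Dec Q) (R? : Dec R) →
             (P → R) → (Q → R) → (P → ¬ Q) → 𝟙 P? + 𝟙 Q? ≤ 𝟙 R?
𝟙-disjoint (yes p) (yes q) R? p→r q→r p→¬q = contradiction q (p→¬q p)
𝟙-disjoint (yes p) (no _)  R? p→r q→r p→¬q = ≤-reflexive (sym (𝟙-yes R? (p→r p)))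
𝟙-disjoint (no _)  Q?      R? p→r q→r p→¬q = 𝟙≤ Q? (λ q → ≤-reflexive (sym (𝟙-yes R? (q→r q))))

module _ (β : ℕ) .{{_ : NonZero β}} where

  InEpoch : ℕ → ℕ → Set
  InEpoch k τ = β ^ k ≤ τ × τ < β ^ suc k

  inEpoch? : ∀ k τ → Dec (InEpoch k τ)
  inEpoch? k τ = (β ^ k ≤? τ) ×-dec (τ <? β ^ suc k)

  -- The epochs are adjacent intervals. Bounding by the indicator of their upper end, instead of by
  -- 1, lets the induction attach the next interval.
  epochs-disjoint : ∀ τ k j → ∑ (downFrom j) (λ i → 𝟙 (inEpoch? (k + i) τ)) ≤ 𝟙 (τ <? β ^ (k + j))
  epochs-disjoint τ k zero    = z≤n
  epochs-disjoint τ k (suc j) = begin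
    𝟙 (inEpoch? (k + j) τ) + ∑ (downFrom j) (λ i → 𝟙 (inEpoch? (k + i) τ))
      ≤⟨ +-monoʳ-≤ (𝟙 (inEpoch? (k + j) τ)) (epochs-disjoint τ k j) ⟩
    𝟙 (inEpoch? (k + j) τ) + 𝟙 (τ <? β ^ (k + j))
      ≤⟨ merge ⟩
    𝟙 (τ <? β ^ suc (k + j))
      ≡⟨ cong (λ l → 𝟙 (τ <? β ^ l)) (sym (+-suc k j)) ⟩
    𝟙 (τ <? β ^ (k + suc j)) ∎
    where
    open ≤-Reasoning
    merge : 𝟙 (inEpoch? (k + j) τ) + 𝟙 (τ <? β ^ (k + j)) ≤ 𝟙 (τ <? β ^ suc (k + j))
    merge = 𝟙-disjoint (inEpoch? (k + j) τ) (τ <? β ^ (k + j)) (τ <? β ^ suc (k + j))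
      proj₂ (λ τ< → <-≤-trans τ< (m≤n*m (β ^ (k + j)) β)) (λ (≤τ , _) → ≤⇒≯ ≤τ)

module Epochs {n m w : ℕ} (ds : DataStructure n m w) (tu tq K : ℕ) (solves : Solves ds tu tq)
              (β t J E : ℕ) .{{_ : NonZero β}} where

  open DataStructure ds

  -- Epochs start at β ^ J and not at 1, since Z has to be large enough to outweigh the transcripts
  -- in `Balance`.
  module At (i : ℕ) = Epoch ds tu tq K solves (β ^ (J + i)) β t

  -- Each query is answered under at least one choice of an epoch and t blocks; as there are E β ^ t
  -- choices, one of them serves at least K queries.
  some-epoch : (∀ i → i < E → β ^ suc (J + i) ≤ n) → tq < E * suc t → 1 ≤ E → K * (E * β ^ t) ≤ m →
               ∀ S x → 1 ≤ ∑ (downFrom E) (λ i → ∑ (At.advices i) (λ a →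
                             𝟙 (At.certified? i (At.claims i a (At.transcript i a S)) S x)))
  some-epoch fits tq< 1≤E K≤ S x = conclude (pigeonhole choices (λ c → ∑ (allFin m) (λ q → f q c)) K
      (subst (1 ≤_) (sym length-choices) (*-mono-≤ 1≤E (m^n>0 β t)))
      (begin
        K * length choices                               ≡⟨ cong (K *_) length-choices ⟩
        K * (E * β ^ t)                                  ≤⟨ K≤ ⟩
        m                                                ≡⟨ sym (Listₚ.length-tabulate {n = m} id) ⟩
        length (allFin m)                                ≡⟨ length≡∑1 (allFin m) ⟩
        ∑ (allFin m) (λ _ → 1)                           ≤⟨ ∑-mono (allFin m) per-query ⟩
        ∑ (allFin m) (λ q → ∑ choices (f q))             ≡⟨ ∑-swap (allFin m) choices f ⟩
        ∑ choices (λ c → ∑ (allFin m) (λ q → f q c))     ∎))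
    where
    open ≤-Reasoning
    module R (i : ℕ) = At.Run i S x

    choices : List (ℕ × Vec ℕ t)
    choices = cartesianProduct (downFrom E) (vecs (upTo β) t)

    length-choices : length choices ≡ E * β ^ t
    length-choices = trans (length-cartesianProduct (downFrom E) (vecs (upTo β) t))
      (cong₂ _*_ (Listₚ.length-downFrom E) (trans (length-vecs (upTo β) t) (cong (_^ t) (Listₚ.length-upTo β))))

    f : Fin m → ℕ × Vec ℕ t → ℕ
    f q (i , bs) = defined (At.claims i (R.advice i bs) (At.transcript i (R.advice i bs) S) (R.certificate i) q)

    -- Neither `writtenAt` nor `query-trace` depends on the epoch, so index 0 may represent all of
    -- them.
    hit : ∀ a → ∃[ τ ] ((∀ σ → σ < τ → ¬ a ∈ R.writtenAt 0 σ) × (τ < n → a ∈ R.writtenAt 0 τ))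
    hit a = firstHit (λ τ → DecMembership._∈?_ _≟ʷ_ a (R.writtenAt 0 τ)) n

    times : Fin m → List ℕ
    times q = map (proj₁ ∘ hit) (Vec.toList (R.query-trace 0 q))

    length-times : ∀ q → length (times q) ≡ tq
    length-times q = trans (Listₚ.length-map (proj₁ ∘ hit) (Vec.toList (R.query-trace 0 q))) (length-toList (R.query-trace 0 q))

    -- The `tq` times of the trace, padding included, fall into disjoint epochs, and tq < E (t + 1)
    -- leaves some epoch with at most t of them.
    per-query : ∀ q → 1 ≤ ∑ choices (f q)
    per-query q with light (downFrom E) (λ i → ∑ (times q) (λ τ → 𝟙 (inEpoch? β (J + i) τ))) t (begin-strict
      ∑ (downFrom E) (λ i → ∑ (times q) (λ τ → 𝟙 (inEpoch? β (J + i) τ)))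
        ≡⟨ ∑-swap (downFrom E) (times q) (λ i τ → 𝟙 (inEpoch? β (J + i) τ)) ⟩
      ∑ (times q) (λ τ → ∑ (downFrom E) (λ i → 𝟙 (inEpoch? β (J + i) τ)))
        ≤⟨ ∑-bound (times q) (λ τ → ≤-trans (epochs-disjoint β τ J E) (𝟙≤ (τ <? β ^ (J + E)) (λ _ → ≤-refl))) ⟩
      length (times q) * 1  ≡⟨ trans (*-identityʳ _) (length-times q) ⟩
      tq                    <⟨ tq< ⟩
      E * suc t             ≡⟨ cong (_* suc t) (sym (Listₚ.length-downFrom E)) ⟩
      length (downFrom E) * suc t ∎)
    ... | i , i∈ , few with collect (inEpoch? β (J + i)) (λ τ → _/_ τ (β ^ (J + i)) {{m^n≢0 β (J + i)}}) β (>-nonZero⁻¹ β)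
                              (λ τ (_ , τ<) → m<n*o⇒m/o<n {{m^n≢0 β (J + i)}} τ<) (times q) t few
    ...   | bs , bs<β , covered = begin
      1                   ≡⟨ sym (R.claimed i (fits i (∈-downFrom⁻ i∈)) bs q (lookup⁻ (λ j → ok (∈-lookup j (R.query-trace 0 q))))) ⟩
      f q (i , bs)        ≤⟨ ∈⇒≤∑ (f q) (∈-cartesianProduct⁺ i∈ (∈-vecs (VecAll.map ∈-upTo⁺ bs<β))) ⟩
      ∑ choices (f q)     ∎
      where
      ok : ∀ {a} → a ∈ R.query-trace 0 q → At.Resolved i (R.known i bs) (R.certificate i) a
      ok {a} a∈ = R.resolved i (fits i (∈-downFrom⁻ i∈)) {{m^n≢0 β (J + i)}} bs (proj₁ (hit a))
        (proj₁ (proj₂ (hit a))) (proj₂ (proj₂ (hit a)))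
        (λ Z≤ <N → covered (proj₁ (hit a)) (∈-map⁺ (proj₁ ∘ hit) (∈-toList⁺ a∈)) (Z≤ , <N))

    conclude : ∃[ c ] (c ∈ₗ choices × K ≤ ∑ (allFin m) (λ q → f q c)) → _
    conclude ((i , bs) , c∈ , K≤f) = ≤-trans
      (R.certified i (fits i (∈-downFrom⁻ i∈)) bs K≤f)
      (∈⇒≤∑ (λ i → ∑ (At.advices i) (λ a → 𝟙 (At.certified? i (At.claims i a (At.transcript i a S)) S x))) i∈)
      where i∈ = proj₁ (∈-cartesianProduct⁻ (downFrom E) (vecs (upTo β) t) c∈)

-- The counting inequality

2^-suc : ∀ x → 2 ^ x + 2 ^ x ≡ 2 * 2 ^ x
2^-suc x = cong (2 ^ x +_) (sym (+-identityʳ (2 ^ x)))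

module Contradiction {n m w : ℕ} (ds : DataStructure n m w) (tu tq K : ℕ) (solves : Solves ds tu tq)
                     (σ t J E : ℕ) where

  β : ℕ
  β = 2 ^ σ

  instance
    β≢0 : NonZero β
    β≢0 = m^n≢0 2 σ

  open Epochs ds tu tq K solves β t J E

  block-size epoch-size advice-bits : ℕ → ℕ
  block-size  i = β ^ (J + i)
  epoch-size  i = β * block-size i
  advice-bits i = (n ∸ epoch-size i) + (w + w) * (suc t * (block-size i * tu))

  length-advices : ∀ i → length (At.advices i) ≤ 2 ^ advice-bits i
  length-advices i = begin
    length (At.advices i)
      ≡⟨ length-cartesianProduct (truncations (n ∸ epoch-size i) n) (vecs pairs l) ⟩
    length (truncations (n ∸ epoch-size i) n) * length (vecs pairs l)
      ≤⟨ *-mono-≤ (length-truncations (n ∸ epoch-size i) n) (≤-reflexive length-pairs) ⟩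
    2 ^ (n ∸ epoch-size i) * 2 ^ ((w + w) * l)
      ≡⟨ sym (^-distribˡ-+-* 2 (n ∸ epoch-size i) _) ⟩
    2 ^ advice-bits i ∎
    where
    open ≤-Reasoning
    l : ℕ
    l = suc t * (block-size i * tu)
    pairs : List (Word w × Word w)
    pairs = cartesianProduct (cube w) (cube w)
    length-pairs : length (vecs pairs l) ≡ 2 ^ ((w + w) * l)
    length-pairs = begin-equality
      length (vecs pairs l)          ≡⟨ length-vecs pairs l ⟩
      length pairs ^ l               ≡⟨ cong (_^ l) (length-cartesianProduct (cube w) (cube w)) ⟩
      (length (cube w) * length (cube w)) ^ l ≡⟨ cong (λ c → (c * c) ^ l) (length-cube w) ⟩
      (2 ^ w * 2 ^ w) ^ l            ≡⟨ cong (_^ l) (sym (^-distribˡ-+-* 2 w w)) ⟩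
      (2 ^ (w + w)) ^ l              ≡⟨ ^-*-assoc 2 (w + w) l ⟩
      2 ^ ((w + w) * l)              ∎

  length-transcripts : ∀ i → length (At.transcripts i) ≡ 2 ^ ((w * tq + 1) * m)
  length-transcripts i = begin
    length (At.transcripts i)                                ≡⟨ length-vecs (cartesianProduct (vecs (cube w) tq) bits) m ⟩
    length (cartesianProduct (vecs (cube w) tq) bits) ^ m    ≡⟨ cong (_^ m) (length-cartesianProduct (vecs (cube w) tq) bits) ⟩
    (length (vecs (cube w) tq) * 2) ^ m                      ≡⟨ cong (λ l → (l * 2) ^ m) (trans (length-matrices w tq) (^-*-assoc 2 w tq)) ⟩
    (2 ^ (w * tq) * 2 ^ 1) ^ m                               ≡⟨ cong (_^ m) (sym (^-distribˡ-+-* 2 (w * tq) 1)) ⟩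
    (2 ^ (w * tq + 1)) ^ m                                   ≡⟨ ^-*-assoc 2 (w * tq + 1) m ⟩
    2 ^ ((w * tq + 1) * m)                                   ∎
    where open ≡-Reasoning

  length-certificates : ∀ i → length (At.certificates i) ≡ 2 ^ (w * (epoch-size i * tu))
  length-certificates i = trans (length-matrices w (epoch-size i * tu)) (^-*-assoc 2 w (epoch-size i * tu))

  accepted : ℕ → ℕ
  accepted i = ∑ (matrices n m) (λ S → ∑ (cube n) (λ x → ∑ (At.advices i) (λ a →
                 𝟙 (At.certified? i (At.claims i a (At.transcript i a S)) S x))))

  -- `small` controls the light matrices: advice and r bits together are σ bits shorter than x.
  -- `rich` controls the heavy ones: r K prescribed products outweigh transcripts, vectors and
  -- certificates. So one epoch serves at most a 2 / 2 ^ σ fraction of the pairs.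
  accepted-bound : ∀ i r →
    advice-bits i + r + σ ≤ n →
    (w * tq + 1) * m + n + r * n + r * (w * (epoch-size i * tu)) ≤ r * K →
    accepted i * 2 ^ σ ≤ 2 * 2 ^ (n * m + n)
  accepted-bound i r small rich = *-cancelʳ-≤ _ _ (2 ^ (r * K)) {{m^n≢0 2 (r * K)}} (begin
    accepted i * 2 ^ σ * 2 ^ (r * K)
      ≡⟨ swap-right (accepted i) (2 ^ σ) (2 ^ (r * K)) ⟩
    accepted i * 2 ^ (r * K) * 2 ^ σ
      ≤⟨ *-monoˡ-≤ (2 ^ σ) (At.pairs-bound i (At.advices i) (At.transcripts i) (At.claims i) (At.transcript i) (At.transcript∈ i) r) ⟩
    length (At.advices i) * (T₁ + T₂) * 2 ^ σ
      ≤⟨ *-monoˡ-≤ (2 ^ σ) (*-mono-≤ (length-advices i) (≤-reflexive (cong₂ _+_ T₁≡ T₂≡))) ⟩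
    2 ^ a * (2 ^ e₁ + 2 ^ e₂) * 2 ^ σ
      ≡⟨ distribute (2 ^ a) (2 ^ e₁) (2 ^ e₂) (2 ^ σ) ⟩
    2 ^ a * 2 ^ e₁ * 2 ^ σ + 2 ^ a * 2 ^ e₂ * 2 ^ σ
      ≡⟨ cong₂ _+_ (merge a e₁ σ) (merge a e₂ σ) ⟩
    2 ^ (a + e₁ + σ) + 2 ^ (a + e₂ + σ)
      ≤⟨ +-mono-≤ (^-monoʳ-≤ 2 exponent₁) (^-monoʳ-≤ 2 exponent₂) ⟩
    2 ^ (n * m + n + r * K) + 2 ^ (n * m + n + r * K)
      ≡⟨ 2^-suc (n * m + n + r * K) ⟩
    2 * 2 ^ (n * m + n + r * K)
      ≡⟨ cong (2 *_) (^-distribˡ-+-* 2 (n * m + n) (r * K)) ⟩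
    2 * (2 ^ (n * m + n) * 2 ^ (r * K))
      ≡⟨ sym (*-assoc 2 (2 ^ (n * m + n)) (2 ^ (r * K))) ⟩
    2 * 2 ^ (n * m + n) * 2 ^ (r * K) ∎)
    where
    open ≤-Reasoning
    a c e₁ e₂ T₁ T₂ : ℕ
    a = advice-bits i
    c = w * (epoch-size i * tu)
    e₁ = n * m + r + r * K
    e₂ = (w * tq + 1) * m + (n * r + c * r + n * m) + n
    T₁ = (2 ^ n) ^ m * 2 ^ r * 2 ^ (r * K)
    T₂ = length (At.transcripts i) * ((2 ^ n) ^ r * length (At.certificates i) ^ r * (2 ^ n) ^ m) * 2 ^ n
    swap-right : ∀ x y z → x * y * z ≡ x * z * y
    swap-right = solve-∀
    distribute : ∀ x y z u → x * (y + z) * u ≡ x * y * u + x * z * u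
    distribute = solve-∀
    merge : ∀ x y z → 2 ^ x * 2 ^ y * 2 ^ z ≡ 2 ^ (x + y + z)
    merge x y z = sym (trans (^-distribˡ-+-* 2 (x + y) z) (cong (_* 2 ^ z) (^-distribˡ-+-* 2 x y)))
    T₁≡ : T₁ ≡ 2 ^ e₁
    T₁≡ = trans (cong (λ u → u * 2 ^ r * 2 ^ (r * K)) (^-*-assoc 2 n m)) (merge (n * m) r (r * K))
    T₂≡ : T₂ ≡ 2 ^ e₂
    T₂≡ = trans (cong₂ (λ u v → u * v * 2 ^ n) (length-transcripts i)
      (trans (cong₂ _*_ (cong₂ _*_ (^-*-assoc 2 n r)
                                   (trans (cong (_^ r) (length-certificates i)) (^-*-assoc 2 c r)))
                        (^-*-assoc 2 n m))
             (merge (n * r) (c * r) (n * m))))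
      (merge ((w * tq + 1) * m) (n * r + c * r + n * m) n)
    exponent₁ : a + e₁ + σ ≤ n * m + n + r * K
    exponent₁ = begin
      a + (n * m + r + r * K) + σ    ≡⟨ rearrange a (n * m) r (r * K) σ ⟩
      n * m + (a + r + σ) + r * K    ≤⟨ +-monoˡ-≤ (r * K) (+-monoʳ-≤ (n * m) small) ⟩
      n * m + n + r * K              ∎
      where
      rearrange : ∀ a x r y σ → a + (x + r + y) + σ ≡ x + (a + r + σ) + y
      rearrange = solve-∀
    exponent₂ : a + e₂ + σ ≤ n * m + n + r * K
    exponent₂ = begin
      a + (y + (n * r + c * r + n * m) + n) + σ          ≡⟨ rearrange a y n r c (n * m) σ ⟩
      n * m + (a + σ) + (y + n + r * n + r * c)          ≤⟨ +-mono-≤ (+-monoʳ-≤ (n * m) (≤-trans (+-monoˡ-≤ σ (m≤m+n a r)) small)) rich ⟩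
      n * m + n + r * K                                  ∎
      where
      y : ℕ
      y = (w * tq + 1) * m
      rearrange : ∀ a y n r c x σ → a + (y + (n * r + c * r + x) + n) + σ ≡ x + (a + σ) + (y + n + r * n + r * c)
      rearrange = solve-∀

  -- Every pair is served by one of E epochs, yet together they reach only a fraction 2 E / 2 ^ σ <
  -- 1.
  impossible : (∀ i → i < E → β ^ suc (J + i) ≤ n) → tq < E * suc t → 1 ≤ E → K * (E * β ^ t) ≤ m →
               2 * E < 2 ^ σ →
               (r : ℕ → ℕ) → (∀ i → i < E → advice-bits i + r i + σ ≤ n) →
               (∀ i → i < E → (w * tq + 1) * m + n + r i * n + r i * (w * (epoch-size i * tu)) ≤ r i * K) → ⊥
  impossible fits tq< 1≤E K≤ 2E< r small rich = <⇒≱ 2E< (*-cancelʳ-≤ (2 ^ σ) (2 * E) T {{m^n≢0 2 (n * m + n)}} (begin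
    2 ^ σ * T
      ≡⟨ *-comm (2 ^ σ) T ⟩
    T * 2 ^ σ
      ≡⟨ cong (_* 2 ^ σ) (sym all-pairs) ⟩
    ∑ (matrices n m) (λ S → ∑ (cube n) (λ x → 1)) * 2 ^ σ
      ≤⟨ *-monoˡ-≤ (2 ^ σ) (∑-mono (matrices n m) (λ S → ∑-mono (cube n) (some-epoch fits tq< 1≤E K≤ S))) ⟩
    ∑ (matrices n m) (λ S → ∑ (cube n) (λ x → ∑ (downFrom E) (λ i → g i S x))) * 2 ^ σ
      ≡⟨ cong (_* 2 ^ σ) (trans (∑-cong (matrices n m) (λ S → ∑-swap (cube n) (downFrom E) (λ x i → g i S x)))
                                (∑-swap (matrices n m) (downFrom E) (λ S i → ∑ (cube n) (g i S)))) ⟩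
    ∑ (downFrom E) accepted * 2 ^ σ
      ≡⟨ sym (∑-*ʳ (downFrom E) accepted (2 ^ σ)) ⟩
    ∑ (downFrom E) (λ i → accepted i * 2 ^ σ)
      ≤⟨ ∑-bound∈ (downFrom E) (λ i i∈ → accepted-bound i (r i) (small i (∈-downFrom⁻ i∈)) (rich i (∈-downFrom⁻ i∈))) ⟩
    length (downFrom E) * (2 * T)
      ≡⟨ cong (_* (2 * T)) (Listₚ.length-downFrom E) ⟩
    E * (2 * T)
      ≡⟨ regroup E T ⟩
    2 * E * T ∎))
    where
    open ≤-Reasoning
    T : ℕ
    T = 2 ^ (n * m + n)
    g : ℕ → Vec (Vec Bool n) m → Vec Bool n → ℕ
    g i S x = ∑ (At.advices i) (λ a → 𝟙 (At.certified? i (At.claims i a (At.transcript i a S)) S x))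
    regroup : ∀ e t → e * (2 * t) ≡ 2 * e * t
    regroup = solve-∀
    all-pairs : ∑ (matrices n m) (λ S → ∑ (cube n) (λ x → 1)) ≡ T
    all-pairs = begin-equality
      ∑ (matrices n m) (λ S → ∑ (cube n) (λ x → 1))  ≡⟨ ∑-const (matrices n m) _ ⟩
      length (matrices n m) * ∑ (cube n) (λ _ → 1)   ≡⟨ cong₂ _*_ (trans (length-matrices n m) (^-*-assoc 2 n m))
                                                          (trans (sym (length≡∑1 (cube n))) (length-cube n)) ⟩
      2 ^ (n * m) * 2 ^ n                            ≡⟨ sym (^-distribˡ-+-* 2 (n * m) n) ⟩
      T                                              ∎

-- Choice of parameters

n<2^1+⌊log₂n⌋ : ∀ n → n < 2 ^ suc ⌊log₂ n ⌋
n<2^1+⌊log₂n⌋ n with suc n ≤? 2 ^ suc ⌊log₂ n ⌋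
... | yes n< = n<
... | no n≮ = contradiction
  (subst (_≤ ⌊log₂ n ⌋) (⌊log₂[2^n]⌋≡n (suc ⌊log₂ n ⌋)) (⌊log₂⌋-mono-≤ (≮⇒≥ n≮))) (<⇒≱ ≤-refl)

⌊log₂⌋-< : ∀ k {n} → 1 ≤ n → n < 2 ^ k → ⌊log₂ n ⌋ < k
⌊log₂⌋-< zero    1≤n n< = contradiction 1≤n (<⇒≱ n<)
⌊log₂⌋-< (suc k) {suc zero}    1≤n n< = s≤s z≤n
⌊log₂⌋-< (suc k) {n@(suc (suc _))} 1≤n n< = s≤s (begin
  ⌊log₂ n ⌋                  ≤⟨ m≤n+m∸n ⌊log₂ n ⌋ 1 ⟩
  1 + (⌊log₂ n ⌋ ∸ 1)        ≡⟨ cong suc (sym (⌊log₂⌊n/2⌋⌋≡⌊log₂n⌋∸1 n)) ⟩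
  1 + ⌊log₂ ⌊ n /2⌋ ⌋        ≤⟨ ⌊log₂⌋-< k (s≤s z≤n) half< ⟩
  k                          ∎)
  where
  open ≤-Reasoning
  half< : ⌊ n /2⌋ < 2 ^ k
  half< = *-cancelˡ-< 2 _ _ (≤-<-trans (begin
    2 * ⌊ n /2⌋              ≡⟨ cong (⌊ n /2⌋ +_) (+-identityʳ ⌊ n /2⌋) ⟩
    ⌊ n /2⌋ + ⌊ n /2⌋        ≤⟨ +-monoʳ-≤ ⌊ n /2⌋ (⌊n/2⌋≤⌈n/2⌉ n) ⟩
    ⌊ n /2⌋ + ⌈ n /2⌉        ≡⟨ ⌊n/2⌋+⌈n/2⌉≡n n ⟩
    n                        ∎) n<)

2^⌊log₂n⌋≤n : ∀ {n} → 1 ≤ n → 2 ^ ⌊log₂ n ⌋ ≤ n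
2^⌊log₂n⌋≤n {n} 1≤n with 2 ^ ⌊log₂ n ⌋ ≤? n
... | yes le = le
... | no ≰n = contradiction (⌊log₂⌋-< ⌊log₂ n ⌋ 1≤n (≰⇒> ≰n)) (<-irrefl refl)

1+n≤2^n : ∀ n → suc n ≤ 2 ^ n
1+n≤2^n zero    = ≤-refl
1+n≤2^n (suc n) = begin
  1 + suc n        ≤⟨ +-mono-≤ (m^n>0 2 n) (1+n≤2^n n) ⟩
  2 ^ n + 2 ^ n    ≡⟨ 2^-suc n ⟩
  2 ^ suc n        ∎
  where open ≤-Reasoning

2+n≤2^n : ∀ {n} → 2 ≤ n → 2 + n ≤ 2 ^ n
2+n≤2^n {n} 2≤n = subst (λ k → 2 + k ≤ 2 ^ k) (m+[n∸m]≡n 2≤n) (go (n ∸ 2))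
  where
  open ≤-Reasoning
  go : ∀ k → 4 + k ≤ 2 ^ (2 + k)
  go zero    = ≤-refl
  go (suc k) = begin
    1 + (4 + k)                   ≤⟨ +-mono-≤ (m^n>0 2 (2 + k)) (go k) ⟩
    2 ^ (2 + k) + 2 ^ (2 + k)     ≡⟨ 2^-suc (2 + k) ⟩
    2 ^ (3 + k)                   ∎

-- At λ′ = 3A, expanding (1 + A)³ ≤ 2 ^ (3A) suffices; from there on the left side grows by A while
-- the right side doubles.
linear≤2^ : ∀ A λ′ → 3 * A ≤ λ′ → A * suc λ′ ≤ 2 ^ λ′
linear≤2^ A λ′ le = subst (λ l → A * suc l ≤ 2 ^ l) (m∸n+n≡m le) (go (λ′ ∸ 3 * A))
  where
  open ≤-Reasoning
  cube-expand : ∀ A → (1 + A) * ((1 + A) * (1 + A)) ≡ A * (1 + 3 * A) + (A * (A * A) + 1 + 2 * A)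
  cube-expand = solve-∀
  base : A * suc (3 * A) ≤ 2 ^ (3 * A)
  base = begin
    A * suc (3 * A)                    ≤⟨ m≤m+n _ _ ⟩
    A * (1 + 3 * A) + (A * (A * A) + 1 + 2 * A) ≡⟨ sym (cube-expand A) ⟩
    (1 + A) * ((1 + A) * (1 + A))      ≤⟨ *-mono-≤ (1+n≤2^n A) (*-mono-≤ (1+n≤2^n A) (1+n≤2^n A)) ⟩
    2 ^ A * (2 ^ A * 2 ^ A)            ≡⟨ cong (2 ^ A *_) (sym (^-distribˡ-+-* 2 A A)) ⟩
    2 ^ A * 2 ^ (A + A)                ≡⟨ sym (^-distribˡ-+-* 2 A (A + A)) ⟩
    2 ^ (A + (A + A))                  ≡⟨ cong (λ x → 2 ^ (A + (A + x))) (sym (+-identityʳ A)) ⟩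
    2 ^ (3 * A)                        ∎
  go : ∀ j → A * suc (j + 3 * A) ≤ 2 ^ (j + 3 * A)
  go zero    = base
  go (suc j) = begin
    A * suc (suc (j + 3 * A))          ≡⟨ *-suc A (suc (j + 3 * A)) ⟩
    A + A * suc (j + 3 * A)            ≤⟨ +-monoˡ-≤ _ (≤-trans (≤-reflexive (sym (*-identityʳ A))) (*-monoʳ-≤ A {1} (s≤s z≤n))) ⟩
    A * suc (j + 3 * A) + A * suc (j + 3 * A) ≤⟨ +-mono-≤ (go j) (go j) ⟩
    2 ^ (j + 3 * A) + 2 ^ (j + 3 * A)  ≡⟨ 2^-suc (j + 3 * A) ⟩
    2 ^ (suc j + 3 * A)                ∎

m<n*1+m/n : ∀ m n .{{_ : NonZero n}} → m < n * suc (m / n)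
m<n*1+m/n m n = begin-strict
  m                      ≡⟨ m≡m%n+[m/n]*n m n ⟩
  m % n + m / n * n      <⟨ +-monoˡ-< (m / n * n) (m%n<n m n) ⟩
  n + m / n * n          ≡⟨ *-comm (suc (m / n)) n ⟩
  n * suc (m / n)        ∎
  where open ≤-Reasoning

m*n≤o⇒m≤o/n : ∀ {m o} n .{{_ : NonZero n}} → m * n ≤ o → m ≤ o / n
m*n≤o⇒m≤o/n {m} {o} n le = s≤s⁻¹ (*-cancelˡ-< n m (suc (o / n)) (begin-strict
  n * m               ≡⟨ *-comm n m ⟩
  m * n               ≤⟨ le ⟩
  o                   <⟨ m<n*1+m/n o n ⟩
  n * suc (o / n)     ∎))
  where open ≤-Reasoning

^-distribʳ-* : ∀ k x y → (x * y) ^ k ≡ x ^ k * y ^ k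
^-distribʳ-* zero    x y = refl
^-distribʳ-* (suc k) x y =
  trans (cong (x * y *_) (^-distribʳ-* k x y)) ([m*n]*[o*p]≡[m*o]*[n*p] x y (x ^ k) (y ^ k))

-- The q-th power of n 2^h is at most n^q n ≤ n^(p+q), and a number exceeding the floor m has a
-- larger q-th power.
n*2^h≤m : ∀ {n p q m h} → 1 ≤ n → 1 ≤ p → IsFloorPow n p q m → 2 ^ (h * q) ≤ n → n * 2 ^ h ≤ m
n*2^h≤m {n} {p} {q} {m} {h} 1≤n 1≤p (_ , m+1>) 2^hq≤n with n * 2 ^ h ≤? m
... | yes le = le
... | no ≰m = contradiction m+1> (≤⇒≯ (begin
  suc m ^ q                 ≤⟨ ^-monoˡ-≤ q (≰⇒> ≰m) ⟩
  (n * 2 ^ h) ^ q           ≡⟨ ^-distribʳ-* q n (2 ^ h) ⟩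
  n ^ q * (2 ^ h) ^ q       ≡⟨ cong (n ^ q *_) (^-*-assoc 2 h q) ⟩
  n ^ q * 2 ^ (h * q)       ≤⟨ *-monoʳ-≤ (n ^ q) (≤-trans 2^hq≤n n≤n^p) ⟩
  n ^ q * n ^ p             ≡⟨ *-comm (n ^ q) (n ^ p) ⟩
  n ^ p * n ^ q             ≡⟨ sym (^-distribˡ-+-* n p q) ⟩
  n ^ (p + q)               ∎))
  where
  open ≤-Reasoning
  n≤n^p : n ≤ n ^ p
  n≤n^p = ≤-trans (≤-reflexive (sym (^-identityʳ n))) (^-monoʳ-≤ n {{>-nonZero 1≤n}} 1≤p)

-- The counting argument with all magnitudes measured against powers of two:
-- σ = 2 + ρ, 2^ρ dominates every polylogarithmic quantity, and n 2^h ≤ m.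
module Balance {n m w : ℕ} (ds : DataStructure n m w) (tu tq : ℕ) (solves : Solves ds tu tq)
  (ρ t J h : ℕ) (1≤n : 1 ≤ n) (2≤ρ : 2 ≤ ρ) (tq< : tq < J * suc t)
  (advice-small : (w + w) * (suc t * tu) ≤ 2 ^ ρ)
  (transcript-small : w * tq + 1 ≤ 2 ^ ρ)
  (J-small : J ≤ 2 ^ ρ)
  (t+2≤J : 2 + t ≤ J) (σ[t+2]≤h : (2 + ρ) * (2 + t) ≤ h)
  (epochs-fit : 2 ^ ((2 + ρ) * (J + J)) ≤ n) (many : n * 2 ^ h ≤ m) where

  -- 2 ^ d = β ^ (t + 1) dominates the number J β ^ t of choices, as J ≤ β; so K queries are
  -- guaranteed to share one choice.
  σ d K : ℕ
  σ = 2 + ρ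
  d = σ * suc t
  K = _/_ m (2 ^ d) {{m^n≢0 2 d}}

  open Contradiction ds tu tq K solves σ t J J
  open ≤-Reasoning

  private
    1≤J : 1 ≤ J
    1≤J = ≤-trans (s≤s z≤n) t+2≤J

    fits : ∀ i → i < J → β ^ suc (J + i) ≤ n
    fits i i<J = begin
      (2 ^ σ) ^ suc (J + i)    ≡⟨ ^-*-assoc 2 σ (suc (J + i)) ⟩
      2 ^ (σ * suc (J + i))    ≤⟨ ^-monoʳ-≤ 2 (*-monoʳ-≤ σ (≤-trans (≤-reflexive (sym (+-suc J i))) (+-monoʳ-≤ J i<J))) ⟩
      2 ^ (σ * (J + J))        ≤⟨ epochs-fit ⟩
      n                        ∎

    J≤β : J ≤ β
    J≤β = ≤-trans J-small (^-monoʳ-≤ 2 (m≤n+m ρ 2))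

    choices-fit : K * (J * β ^ t) ≤ m
    choices-fit = begin
      K * (J * β ^ t)         ≤⟨ *-monoʳ-≤ K (*-monoˡ-≤ (β ^ t) J≤β) ⟩
      K * (β * β ^ t)         ≡⟨ cong (K *_) (^-*-assoc 2 σ (suc t)) ⟩
      K * 2 ^ d               ≤⟨ m/n*n≤m m (2 ^ d) {{m^n≢0 2 d}} ⟩
      m                       ∎

    2J<2^σ : 2 * J < 2 ^ σ
    2J<2^σ = begin-strict
      2 * J            ≤⟨ *-monoʳ-≤ 2 J-small ⟩
      2 ^ suc ρ        <⟨ ^-monoʳ-< 2 ≤-refl {suc ρ} {σ} ≤-refl ⟩
      2 ^ σ            ∎

    -- Half of the epoch's 4 * 2 ^ ρ * Z updates. In `small` the other half is split evenly between
    -- the advised cells and σ.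
    r : ℕ → ℕ
    r i = 2 * 2 ^ ρ * block-size i

    r+r≡N : ∀ i → r i + r i ≡ epoch-size i
    r+r≡N i = double (2 ^ ρ) (block-size i)
      where
      double : ∀ x y → 2 * x * y + 2 * x * y ≡ 2 * (2 * x) * y
      double = solve-∀

    1≤Z : ∀ i → 1 ≤ block-size i
    1≤Z i = m^n>0 β (J + i)

    σ≤2^ρ : σ ≤ 2 ^ ρ
    σ≤2^ρ = 2+n≤2^n 2≤ρ

    small : ∀ i → i < J → advice-bits i + r i + σ ≤ n
    small i i<J = begin
      (n ∸ N) + v + r i + σ             ≡⟨ regroup (n ∸ N) v (r i) σ ⟩
      (n ∸ N) + (v + σ + r i)           ≤⟨ +-monoʳ-≤ (n ∸ N) (+-monoˡ-≤ (r i) (+-mono-≤ v≤ (≤-trans σ≤2^ρ (m≤m*n (2 ^ ρ) Z {{>-nonZero (1≤Z i)}})))) ⟩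
      (n ∸ N) + (2 ^ ρ * Z + 2 ^ ρ * Z + r i) ≡⟨ cong (n ∸ N +_) (cong (_+ r i) (twice (2 ^ ρ) Z)) ⟩
      (n ∸ N) + (r i + r i)             ≡⟨ cong (n ∸ N +_) (r+r≡N i) ⟩
      (n ∸ N) + N                       ≡⟨ m∸n+n≡m (fits i i<J) ⟩
      n                                 ∎
      where
      N Z v : ℕ
      N = epoch-size i
      Z = block-size i
      v = (w + w) * (suc t * (Z * tu))
      regroup : ∀ a b c d → a + b + c + d ≡ a + (b + d + c)
      regroup = solve-∀
      twice : ∀ x y → x * y + x * y ≡ 2 * x * y
      twice = solve-∀
      pull : ∀ x y z u → x * (y * (z * u)) ≡ x * (y * u) * z
      pull = solve-∀
      v≤ : v ≤ 2 ^ ρ * Z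
      v≤ = begin
        (w + w) * (suc t * (Z * tu))   ≡⟨ pull (w + w) (suc t) Z tu ⟩
        (w + w) * (suc t * tu) * Z     ≤⟨ *-monoˡ-≤ Z advice-small ⟩
        2 ^ ρ * Z                      ∎

    d+σ≡ : d + σ ≡ σ * (2 + t)
    d+σ≡ = trans (+-comm d σ) (sym (*-suc σ (suc t)))

    2^d-many : n * 2 ^ σ * 2 ^ d ≤ m
    2^d-many = begin
      n * 2 ^ σ * 2 ^ d       ≡⟨ *-assoc n (2 ^ σ) (2 ^ d) ⟩
      n * (2 ^ σ * 2 ^ d)     ≡⟨ cong (n *_) (sym (^-distribˡ-+-* 2 σ d)) ⟩
      n * 2 ^ (σ + d)         ≤⟨ *-monoʳ-≤ n (^-monoʳ-≤ 2 (≤-trans (≤-reflexive (trans (+-comm σ d) d+σ≡)) σ[t+2]≤h)) ⟩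
      n * 2 ^ h               ≤⟨ many ⟩
      m                       ∎

    n2^σ≤K : n * 2 ^ σ ≤ K
    n2^σ≤K = m*n≤o⇒m≤o/n (2 ^ d) {{m^n≢0 2 d}} 2^d-many

    1≤K : 1 ≤ K
    1≤K = ≤-trans (*-mono-≤ 1≤n (m^n>0 2 σ)) n2^σ≤K

    m≤K : m ≤ 2 * 2 ^ d * K
    m≤K = begin
      m                     ≤⟨ <⇒≤ (m<n*1+m/n m (2 ^ d) {{m^n≢0 2 d}}) ⟩
      2 ^ d * suc K         ≤⟨ *-monoʳ-≤ (2 ^ d) (+-monoˡ-≤ K 1≤K) ⟩
      2 ^ d * (K + K)       ≡⟨ double (2 ^ d) K ⟩
      2 * 2 ^ d * K         ∎
      where
      double : ∀ x y → x * (y + y) ≡ 2 * x * y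
      double = solve-∀

    w*tu≤ : w * tu ≤ 2 ^ ρ
    w*tu≤ = ≤-trans (*-mono-≤ (m≤m+n w w) (m≤n*m tu (suc t))) advice-small

    -- After doubling, one r K pays for the transcripts and the other for vectors and certificates,
    -- whose cost per vector is at most n 2 ^ σ ≤ K.
    rich : ∀ i → i < J → (w * tq + 1) * m + n + r i * n + r i * (w * (epoch-size i * tu)) ≤ r i * K
    rich i i<J = *-cancelˡ-≤ 2 (begin
      2 * ((w * tq + 1) * m + n + r i * n + r i * (w * (N * tu)))
        ≤⟨ *-monoʳ-≤ 2 (+-mono-≤ (+-monoˡ-≤ (r i * n) (+-monoʳ-≤ ((w * tq + 1) * m) (m≤n*m n (r i) {{>-nonZero 1≤r}})))
             (*-monoʳ-≤ (r i) (*-monoʳ-≤ w (*-monoˡ-≤ tu (fits i i<J))))) ⟩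
      2 * ((w * tq + 1) * m + r i * n + r i * n + r i * (w * (n * tu)))
        ≡⟨ split (w * tq + 1) m (r i) n w tu ⟩
      2 * (w * tq + 1) * m + r i * (n * (2 * (2 + w * tu)))
        ≤⟨ +-mono-≤ (*-mono-≤ (*-monoʳ-≤ 2 transcript-small) m≤K) (*-monoʳ-≤ (r i) (*-monoʳ-≤ n per-point)) ⟩
      2 * 2 ^ ρ * (2 * 2 ^ d * K) + r i * (n * 2 ^ σ)
        ≤⟨ +-mono-≤ transcripts-fit (*-monoʳ-≤ (r i) n2^σ≤K) ⟩
      r i * K + r i * K
        ≡⟨ cong (r i * K +_) (sym (+-identityʳ (r i * K))) ⟩
      2 * (r i * K) ∎)
      where
      N : ℕ
      N = epoch-size i
      1≤r : 1 ≤ r i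
      1≤r = *-mono-≤ (*-mono-≤ (s≤s {0} {1} z≤n) (m^n>0 2 ρ)) (1≤Z i)
      split : ∀ x m r n w u → 2 * (x * m + r * n + r * n + r * (w * (n * u))) ≡ 2 * x * m + r * (n * (2 * (2 + w * u)))
      split = solve-∀
      per-point : 2 * (2 + w * tu) ≤ 2 ^ σ
      per-point = *-monoʳ-≤ 2 (begin
        2 + w * tu          ≤⟨ +-mono-≤ (≤-trans (m≤m+n 2 ρ) σ≤2^ρ) w*tu≤ ⟩
        2 ^ ρ + 2 ^ ρ       ≡⟨ 2^-suc ρ ⟩
        2 ^ suc ρ           ∎)
      transcripts-fit : 2 * 2 ^ ρ * (2 * 2 ^ d * K) ≤ r i * K
      transcripts-fit = begin
        2 * 2 ^ ρ * (2 * 2 ^ d * K)     ≡⟨ regroup (2 ^ ρ) (2 ^ d) K ⟩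
        2 * (2 * 2 ^ ρ) * 2 ^ d * K     ≡⟨ cong (_* K) (sym (^-distribˡ-+-* 2 σ d)) ⟩
        2 ^ (σ + d) * K                 ≡⟨ cong (λ x → 2 ^ x * K) (trans (+-comm σ d) d+σ≡) ⟩
        2 ^ (σ * (2 + t)) * K           ≡⟨ cong (_* K) (sym (^-*-assoc 2 σ (2 + t))) ⟩
        β ^ (2 + t) * K                 ≤⟨ *-monoˡ-≤ K (^-monoʳ-≤ β (≤-trans t+2≤J (m≤m+n J i))) ⟩
        -- This is where Z ≥ β ^ J is used, together with t + 2 ≤ J.
        block-size i * K                ≤⟨ *-monoˡ-≤ K (m≤n*m (block-size i) (2 * 2 ^ ρ) {{m*n≢0 2 (2 ^ ρ) {{_}} {{m^n≢0 2 ρ}}}}) ⟩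
        r i * K                         ∎
        where
        regroup : ∀ x y k → 2 * x * (2 * y * k) ≡ 2 * (2 * x) * y * k
        regroup = solve-∀

  absurd : ⊥
  absurd = impossible fits tq< 1≤J choices-fit 2J<2^σ r small rich

-- Concrete constants and the asymptotic bounds

module Parameters (p q κ b : ℕ) (1≤p : 1 ≤ p) (1≤q : 1 ≤ q) where

  -- C gives σ ≤ C μ, and D is 16 q (2 C)² because σ ≤ 2 C l. The threshold makes log log n at least
  -- 3 A, so that A μ ≤ L by `linear≤2^`.
  C A D threshold : ℕ
  C = 6 + (b + κ)
  A = 8 * q * C
  D = 64 * q * (C * C)
  threshold = 2 ^ (2 ^ (3 * A))

  1≤A : 1 ≤ A
  1≤A = *-mono-≤ (*-mono-≤ (s≤s {0} {7} z≤n) 1≤q) (s≤s {0} {5 + (b + κ)} z≤n)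

  1≤D : 1 ≤ D
  1≤D = *-mono-≤ (*-mono-≤ (s≤s {0} {63} z≤n) 1≤q) (s≤s {0} z≤n)

  module _ {n m w : ℕ} (n≥ : threshold ≤ n) (m≡⌊n^1+c⌋ : IsFloorPow n p q m) (w≤ : w ≤ b * ⌊log₂ n ⌋)
           (tu tq : ℕ) (ds : DataStructure n m w) (solves : Solves ds tu tq)
           (tu≤ : tu ≤ ⌊log₂ n ⌋ ^ κ)
           (fast : D * tq * ⌊log₂ ⌊log₂ n ⌋ ⌋ ^ 2 < ⌊log₂ n ⌋ ^ 2) where

    -- In units of μ, ρ collects the exponents of the polylogarithmic factors: b + 1 for w, 2 for
    -- `tq`, κ for `tu` and 1 for the doubling. J makes β ^ (2 J) ≤ n, and h makes 2 ^ (h q) ≤ n.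
    L l μ ρ σ J h : ℕ
    L = ⌊log₂ n ⌋
    l = ⌊log₂ L ⌋
    μ = suc l
    ρ = (4 + (b + κ)) * μ
    σ = 2 + ρ
    J = L / (2 * σ)
    h = _/_ L q {{>-nonZero 1≤q}}

    open ≤-Reasoning

    private
      1≤n : 1 ≤ n
      1≤n = ≤-trans (m^n>0 2 (2 ^ (3 * A))) n≥

      2^3A≤L : 2 ^ (3 * A) ≤ L
      2^3A≤L = ≤-trans (≤-reflexive (sym (⌊log₂[2^n]⌋≡n (2 ^ (3 * A))))) (⌊log₂⌋-mono-≤ n≥)

      1≤L : 1 ≤ L
      1≤L = ≤-trans (m^n>0 2 (3 * A)) 2^3A≤L

      3A≤l : 3 * A ≤ l
      3A≤l = ≤-trans (≤-reflexive (sym (⌊log₂[2^n]⌋≡n (3 * A)))) (⌊log₂⌋-mono-≤ 2^3A≤L)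

      1≤l : 1 ≤ l
      1≤l = ≤-trans (*-mono-≤ (s≤s {0} {2} z≤n) 1≤A) 3A≤l

      L≤2^μ : L ≤ 2 ^ μ
      L≤2^μ = <⇒≤ (n<2^1+⌊log₂n⌋ L)

      2^L≤n : 2 ^ L ≤ n
      2^L≤n = 2^⌊log₂n⌋≤n 1≤n

      σ≤Cμ : σ ≤ C * μ
      σ≤Cμ = begin
        2 + ρ                         ≤⟨ +-monoˡ-≤ ρ (*-monoʳ-≤ 2 {1} {μ} (s≤s z≤n)) ⟩
        2 * μ + (4 + (b + κ)) * μ     ≡⟨ sym (*-distribʳ-+ μ 2 (4 + (b + κ))) ⟩
        C * μ                         ∎

      8qσ≤L : 8 * q * σ ≤ L
      8qσ≤L = begin
        8 * q * σ          ≤⟨ *-monoʳ-≤ (8 * q) σ≤Cμ ⟩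
        8 * q * (C * μ)    ≡⟨ sym (*-assoc (8 * q) C μ) ⟩
        A * μ              ≤⟨ linear≤2^ A l 3A≤l ⟩
        2 ^ l              ≤⟨ 2^⌊log₂n⌋≤n 1≤L ⟩
        L                  ∎

      1≤J : 1 ≤ J
      1≤J = m*n≤o⇒m≤o/n (2 * σ) (begin
        1 * (2 * σ)        ≡⟨ *-identityˡ (2 * σ) ⟩
        2 * σ              ≤⟨ *-monoˡ-≤ σ (*-mono-≤ {2} {8} (s≤s (s≤s z≤n)) 1≤q) ⟩
        8 * q * σ          ≤⟨ 8qσ≤L ⟩
        L                  ∎)

    t : ℕ
    t = _/_ tq J {{>-nonZero 1≤J}}

    private
      L≤4σJ : L ≤ 2 * σ * (J + J)
      L≤4σJ = ≤-trans (<⇒≤ (m<n*1+m/n L (2 * σ))) (*-monoʳ-≤ (2 * σ) (+-monoˡ-≤ J 1≤J))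

      μ≤2l : μ ≤ 2 * l
      μ≤2l = ≤-trans (+-monoˡ-≤ l 1≤l) (≤-reflexive (cong (l +_) (sym (+-identityʳ l))))

      -- The decisive use of `fast`. Multiplying by L ≤ 4 σ J gives 16 q σ² t J; with t J ≤ tq and σ
      -- ≤ 2 C l this is at most D tq l², which is below L².
      4qσt≤L : 4 * q * σ * t ≤ L
      4qσt≤L = <⇒≤ (*-cancelʳ-< L (4 * q * σ * t) L (begin-strict
        4 * q * σ * t * L                          ≤⟨ *-monoʳ-≤ (4 * q * σ * t) L≤4σJ ⟩
        4 * q * σ * t * (2 * σ * (J + J))          ≡⟨ gather q σ t J ⟩
        16 * q * (σ * σ) * (t * J)                 ≤⟨ *-mono-≤ (*-monoʳ-≤ (16 * q) (*-mono-≤ σ≤2Cl σ≤2Cl)) (m/n*n≤m tq J {{>-nonZero 1≤J}}) ⟩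
        16 * q * (C * (2 * l) * (C * (2 * l))) * tq ≡⟨ constant q C l tq ⟩
        D * tq * (l * (l * 1))                     <⟨ fast ⟩
        L * (L * 1)                                ≡⟨ cong (L *_) (*-identityʳ L) ⟩
        L * L                                      ∎))
        where
        σ≤2Cl : σ ≤ C * (2 * l)
        σ≤2Cl = ≤-trans σ≤Cμ (*-monoʳ-≤ C μ≤2l)
        gather : ∀ q s t j → 4 * q * s * t * (2 * s * (j + j)) ≡ 16 * q * (s * s) * (t * j)
        gather = solve-∀
        constant : ∀ q c l x → 16 * q * (c * (2 * l) * (c * (2 * l))) * x ≡ 64 * q * (c * c) * x * (l * (l * 1))
        constant = solve-∀

      -- Supplies both upper bounds on t, the one against J and the one against h.
      2qσ[2+t]≤L : 2 * q * σ * (2 + t) ≤ L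
      2qσ[2+t]≤L = *-cancelˡ-≤ 2 (begin
        2 * (2 * q * σ * (2 + t))          ≡⟨ expand q σ t ⟩
        4 * q * σ * t + 8 * q * σ          ≤⟨ +-mono-≤ 4qσt≤L 8qσ≤L ⟩
        L + L                              ≡⟨ cong (L +_) (sym (+-identityʳ L)) ⟩
        2 * L                              ∎)
        where
        expand : ∀ q s t → 2 * (2 * q * s * (2 + t)) ≡ 4 * q * s * t + 8 * q * s
        expand = solve-∀

      t+2≤J : 2 + t ≤ J
      t+2≤J = m*n≤o⇒m≤o/n (2 * σ) (begin
        (2 + t) * (2 * σ)                  ≤⟨ m≤n*m _ q {{>-nonZero 1≤q}} ⟩
        q * ((2 + t) * (2 * σ))            ≡⟨ commute q σ t ⟩
        2 * q * σ * (2 + t)                ≤⟨ 2qσ[2+t]≤L ⟩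
        L                                  ∎)
        where
        commute : ∀ q s t → q * ((2 + t) * (2 * s)) ≡ 2 * q * s * (2 + t)
        commute = solve-∀

      σ[t+2]≤h : σ * (2 + t) ≤ h
      σ[t+2]≤h = m*n≤o⇒m≤o/n q {{>-nonZero 1≤q}} (begin
        σ * (2 + t) * q                    ≤⟨ m≤n*m _ 2 ⟩
        2 * (σ * (2 + t) * q)              ≡⟨ commute q σ t ⟩
        2 * q * σ * (2 + t)                ≤⟨ 2qσ[2+t]≤L ⟩
        L                                  ∎)
        where
        commute : ∀ q s t → 2 * (s * (2 + t) * q) ≡ 2 * q * s * (2 + t)
        commute = solve-∀

      epochs-fit : 2 ^ (σ * (J + J)) ≤ n
      epochs-fit = ≤-trans (^-monoʳ-≤ 2 (begin
        σ * (J + J)        ≡⟨ commute σ J ⟩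
        J * (2 * σ)        ≤⟨ m/n*n≤m L (2 * σ) ⟩
        L                  ∎)) 2^L≤n
        where
        commute : ∀ s j → s * (j + j) ≡ j * (2 * s)
        commute = solve-∀

      many : n * 2 ^ h ≤ m
      many = n*2^h≤m {q = q} {h = h} 1≤n 1≤p m≡⌊n^1+c⌋
        (≤-trans (^-monoʳ-≤ 2 (m/n*n≤m L q {{>-nonZero 1≤q}})) 2^L≤n)

      L^k≤ : ∀ k → L ^ k ≤ 2 ^ (μ * k)
      L^k≤ k = ≤-trans (^-monoˡ-≤ k L≤2^μ) (≤-reflexive (^-*-assoc 2 μ k))

      w≤2^ : w ≤ 2 ^ (b + μ)
      w≤2^ = begin
        w                  ≤⟨ w≤ ⟩
        b * L              ≤⟨ *-mono-≤ (≤-trans (n≤1+n b) (1+n≤2^n b)) L≤2^μ ⟩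
        2 ^ b * 2 ^ μ      ≡⟨ sym (^-distribˡ-+-* 2 b μ) ⟩
        2 ^ (b + μ)        ∎

      -- A crude bound, sufficient to make the `tq` factors polylogarithmic and thus absorbed by 2 ^
      -- ρ.
      tq<L² : tq < L ^ 2
      tq<L² = ≤-<-trans (≤-trans (m≤n*m tq D {{>-nonZero 1≤D}})
        (m≤m*n (D * tq) (l ^ 2) {{m^n≢0 l 2 {{>-nonZero 1≤l}}}})) fast

      b≤bμ : b ≤ b * μ
      b≤bμ = m≤m*n b μ

      advice-small : (w + w) * (suc t * tu) ≤ 2 ^ ρ
      advice-small = begin
        (w + w) * (suc t * tu)
          ≤⟨ *-mono-≤ (≤-trans (+-mono-≤ w≤2^ w≤2^) (≤-reflexive (2^-suc (b + μ))))
               (*-mono-≤ (≤-trans (≤-<-trans (m/n≤m tq J {{>-nonZero 1≤J}}) tq<L²) (L^k≤ 2)) (≤-trans tu≤ (L^k≤ κ))) ⟩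
        2 ^ (1 + (b + μ)) * (2 ^ (μ * 2) * 2 ^ (μ * κ))
          ≡⟨ cong (2 ^ (1 + (b + μ)) *_) (sym (^-distribˡ-+-* 2 (μ * 2) (μ * κ))) ⟩
        2 ^ (1 + (b + μ)) * 2 ^ (μ * 2 + μ * κ)
          ≡⟨ sym (^-distribˡ-+-* 2 (1 + (b + μ)) (μ * 2 + μ * κ)) ⟩
        2 ^ (1 + (b + μ) + (μ * 2 + μ * κ))
          ≤⟨ ^-monoʳ-≤ 2 exponent ⟩
        2 ^ ρ ∎
        where
        expand : ∀ b k u → u + (b * u + u) + (u * 2 + u * k) ≡ (4 + (b + k)) * u
        expand = solve-∀
        exponent : 1 + (b + μ) + (μ * 2 + μ * κ) ≤ ρ
        exponent = begin
          1 + (b + μ) + (μ * 2 + μ * κ)       ≤⟨ +-monoˡ-≤ (μ * 2 + μ * κ) (+-mono-≤ {1} {μ} (s≤s z≤n) (+-monoˡ-≤ μ b≤bμ)) ⟩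
          μ + (b * μ + μ) + (μ * 2 + μ * κ)   ≡⟨ expand b κ μ ⟩
          ρ                                   ∎

      transcript-small : w * tq + 1 ≤ 2 ^ ρ
      transcript-small = begin
        w * tq + 1
          ≤⟨ +-mono-≤ (*-mono-≤ w≤2^ (≤-trans (<⇒≤ tq<L²) (L^k≤ 2))) (m^n>0 2 (b + μ + μ * 2)) ⟩
        2 ^ (b + μ) * 2 ^ (μ * 2) + 2 ^ (b + μ + μ * 2)
          ≡⟨ cong (_+ 2 ^ (b + μ + μ * 2)) (sym (^-distribˡ-+-* 2 (b + μ) (μ * 2))) ⟩
        2 ^ (b + μ + μ * 2) + 2 ^ (b + μ + μ * 2)
          ≡⟨ 2^-suc (b + μ + μ * 2) ⟩
        2 ^ (1 + (b + μ + μ * 2))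
          ≤⟨ ^-monoʳ-≤ 2 exponent ⟩
        2 ^ ρ ∎
        where
        expand : ∀ b k u → u + (b * u + u + u * 2) + k * u ≡ (4 + (b + k)) * u
        expand = solve-∀
        exponent : 1 + (b + μ + μ * 2) ≤ ρ
        exponent = begin
          1 + (b + μ + μ * 2)                 ≤⟨ +-mono-≤ {1} {μ} (s≤s z≤n) (+-monoˡ-≤ (μ * 2) (+-monoˡ-≤ μ b≤bμ)) ⟩
          μ + (b * μ + μ + μ * 2)             ≤⟨ m≤m+n _ (κ * μ) ⟩
          μ + (b * μ + μ + μ * 2) + κ * μ     ≡⟨ expand b κ μ ⟩
          ρ                                   ∎

      J-small : J ≤ 2 ^ ρ
      J-small = ≤-trans (m/n≤m L (2 * σ)) (≤-trans L≤2^μ (^-monoʳ-≤ 2 (m≤n*m μ (4 + (b + κ)))))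

      2≤ρ : 2 ≤ ρ
      2≤ρ = *-mono-≤ {2} {4 + (b + κ)} {1} {μ} (s≤s (s≤s z≤n)) (s≤s z≤n)

    too-fast : ⊥
    too-fast = Balance.absurd ds tu tq solves ρ t J h 1≤n 2≤ρ (m<n*1+m/n tq J {{>-nonZero 1≤J}})
      advice-small transcript-small J-small t+2≤J σ[t+2]≤h epochs-fit many

theorem1 : (p q κ a b : ℕ) → p ≥ 1 → q ≥ 1 → a ≥ 1 → b ≥ 1 →
    ∃[ D ] ((D ≥ 1) × ∃[ n₀ ] ((n m w : ℕ) → n ≥ n₀ → IsFloorPow n p q m →
    ⌊log₂ n ⌋ ≤ a * w → w ≤ b * ⌊log₂ n ⌋ →
    (tu tq : ℕ) (ds : DataStructure n m w) → Solves ds tu tq →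
    tu ≤ ⌊log₂ n ⌋ ^ κ →
    ⌊log₂ n ⌋ ^ 2 ≤ D * tq * ⌊log₂ ⌊log₂ n ⌋ ⌋ ^ 2))
theorem1 p q κ a b 1≤p 1≤q _ _ = D , 1≤D , threshold ,
  λ n m w n≥ floor _ w≤ tu tq ds solves tu≤ → ≮⇒≥ (too-fast n≥ floor w≤ tu tq ds solves tu≤)
  where open Parameters p q κ b 1≤p 1≤q
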